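{- Let $n$ be a positive integer. Let $d=a(b+c)=ab+ac\in\mathfrak A$ and define blocks $L_1,\dots,L_{2n}$ by $L_j=c$ for $j$ odd and $L_j=d$ for $j$ even. For $0\le i\le 2n$ put $S_i=L_{i+1}\star L_{i+2}\star\cdots\star L_{2n}$, and $P_i=L_1\star L_2\star\cdots\star L_i$ if $i$ is odd, $P_i=L_i\star L_{i-1}\star\cdots\star L_1$ if $i$ is even (an empty $\star$-product is the empty word $\mathbf 1$). Set $\Delta_i=P_i\sqcup\!\sqcup\, S_i-P_i* S_i$. Then the following identity holds in $\mathfrak A$: $$2^n(ac^2ab^2)^{\lfloor n/2\rfloor}(ac^2)^{2\{n/2\}}=(a^2(b+c))^n+\sum_{i=0}^{2n}(-1)^{n-i}\Delta_i ,$$ where $\lfloor x\rfloor$ and $\{x\}$ denote the integral and fractional parts of $x$ (so $(ac^2)^{2\{n/2\}}$ is $ac^2$ if $n$ is odd and $\mathbf 1$ if $n$ is even), and all powers of words are ordinary concatenation powers.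
   Context: $\mathfrak A=\mathbb Q\langle a,b,c\rangle$ is the free noncommutative polynomial algebra over $\mathbb Q$ on letters $a,b,c$; words are monomials, $\mathbf 1$ is the empty word. For $k\ge1$ put $\beta_k=a^{k-1}b$, $\gamma_k=a^{k-1}c$. $\mathfrak A^1$ is the $\mathbb Q$-span of words not ending in $a$; each such word factors uniquely as a product of $\beta_k$'s and $\gamma_k$'s. Shuffle product $\sqcup\!\sqcup$ on $\mathfrak A$: bilinear, $\mathbf 1\sqcup\!\sqcup w=w\sqcup\!\sqcup\mathbf 1=w$, and $(xu)\sqcup\!\sqcup(yv)=x(u\sqcup\!\sqcup yv)+y(xu\sqcup\!\sqcup v)$ for letters $x,y\in\{a,b,c\}$ and words $u,v$. Stuffle product $*$ on $\mathfrak A^1$: define the linear maps $M_{\beta_k}=\mathrm{id}$ and $M_{\gamma_k}=$ the algebra automorphism swapping the letters $b$ and $c$ (fixing $a$). Define $[\beta_m,\beta_n]=[\gamma_m,\gamma_n]=\beta_{m+n}$, $[\beta_m,\gamma_n]=[\gamma_m,\beta_n]=\gamma_{m+n}$. Then $*$ is bilinear, $\mathbf 1*w=w*\mathbf 1=w$, and for $x,y\in\{\beta_k,\gamma_k:k\ge1\}$ and words $w_1,w_2\in\mathfrak A^1$: $xw_1*yw_2=x\,M_x\big(M_x(w_1)*yw_2\big)+y\,M_y\big(xw_1*M_y(w_2)\big)+[x,y]\,M_{[x,y]}\big(M_x(w_1)*M_y(w_2)\big)$. $\star$-concatenation: for words $u,v$, if $u$ ends in $b$ and $v=bv'$, then $u\star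 v=u\,c\,v'$; if $u$ ends in $c$ and $v=cv'$, then $u\star v=u\,b\,v'$; otherwise $u\star v=uv$ (so $b\star b=bc$, $c\star c=cb$). Extend bilinearly; iterated $\star$-products are evaluated left to right. E.g. $d\star c=abc+acb$. -}

module Defs where

open import Relation.Binary.PropositionalEquality using (_≡_)
import Data.List

open import Data.Nat as ℕ using (ℕ; zero; suc)
open import Data.Bool using (Bool; true; false; if_then_else_; not; _xor_)
import Data.Maybe
import Data.Integer
open import Data.List using (List; []; _∷_; _++_; map; foldl; foldr; length; concatMap)
open import Data.Maybe using (Maybe; just; nothing)
open import Data.Product using (_×_; _,_)
open import Data.Rational as Q using (ℚ; 0ℚ; 1ℚ)

data Letter : Set where
  a b c : Letter

Word : Set
Word = List Letter

_==L_ : Letter → Letter → Bool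
a ==L a = true
b ==L b = true
c ==L c = true
_ ==L _ = false

_==W_ : Word → Word → Bool
[] ==W [] = true
(x ∷ u) ==W (y ∷ v) = if x ==L y then u ==W v else false
_ ==W _ = false

wpow : Word → ℕ → Word
wpow w zero = []
wpow w (suc k) = w ++ wpow w k

-- Elements of 𝔄 = ℚ⟨a,b,c⟩ as formal finite ℚ-linear combinations of
-- words; two such are equal in 𝔄 iff all coefficients agree (_≈_).

Poly : Set
Poly = List (ℚ × Word)

coeff : Poly → Word → ℚ
coeff [] w = 0ℚ
coeff ((q , u) ∷ p) w = if u ==W w then q Q.+ coeff p w else coeff p w

infix 4 _≈_
_≈_ : Poly → Poly → Set
p ≈ q = ∀ w → coeff p w ≡ coeff q w


word : Word → Poly
word w = (1ℚ , w) ∷ []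

one : Poly
one = word []

zeroP : Poly
zeroP = []

infixl 6 _⊕_ _⊖_
_⊕_ : Poly → Poly → Poly
p ⊕ q = p ++ q

scale : ℚ → Poly → Poly
scale r = map (λ { (q , u) → (r Q.* q , u) })

_⊖_ : Poly → Poly → Poly
p ⊖ q = p ⊕ scale (Q.- 1ℚ) q

infixl 7 _·_
_·_ : Poly → Poly → Poly
p · q = concatMap (λ { (r , u) → map (λ { (s , v) → (r Q.* s , u ++ v) }) q }) p

ppow : Poly → ℕ → Poly
ppow p zero = one
ppow p (suc k) = p · ppow p k

prefixW : Word → Poly → Poly
prefixW u = map (λ { (q , v) → (q , u ++ v) })

linW : (Word → Poly) → Poly → Poly
linW f = concatMap (λ { (q , u) → scale q (f u) })

bilinW : (Word → Word → Poly) → Poly → Poly → Poly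
bilinW f p q = concatMap (λ { (r , u) → concatMap (λ { (s , v) → scale (r Q.* s) (f u v) }) q }) p

shW : Word → Word → Poly
shW [] v = word v
shW (x ∷ u) [] = word (x ∷ u)
shW (x ∷ u) (y ∷ v) = prefixW (x ∷ []) (shW u (y ∷ v)) ⊕ prefixW (y ∷ []) (shW (x ∷ u) v)

infixl 7 _ш_
_ш_ : Poly → Poly → Poly
_ш_ = bilinW shW

-- Stuffle product on 𝔄¹.
-- A word of 𝔄¹ factors uniquely into blocks β_k = a^{k-1}b, γ_k = a^{k-1}c.
-- Block (false , m) = β_{m+1},  block (true , m) = γ_{m+1}.

Block : Set
Block = Bool × ℕ

blockWord : Block → Word
blockWord (false , m) = wpow (a ∷ []) m ++ (b ∷ [])
blockWord (true , m) = wpow (a ∷ []) m ++ (c ∷ [])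

blocksWord : List Block → Word
blocksWord = foldr (λ x w → blockWord x ++ w) []

-- factorisation of a word into blocks (m counts pending a's);
-- the result is nothing iff the word ends in a, i.e. is not in 𝔄¹
factorAux : ℕ → Word → Maybe (List Block)
factorAux zero [] = just []
factorAux (suc m) [] = nothing
factorAux m (a ∷ w) = factorAux (suc m) w
factorAux m (b ∷ w) = Data.Maybe.map ((false , m) ∷_) (factorAux 0 w)
factorAux m (c ∷ w) = Data.Maybe.map ((true , m) ∷_) (factorAux 0 w)

factor : Word → Maybe (List Block)
factor = factorAux 0

swapL : Letter → Letter
swapL a = a
swapL b = c
swapL c = b

swapPoly : Poly → Poly
swapPoly = map (λ { (q , u) → (q , map swapL u) })

Mpoly : Block → Poly → Poly
Mpoly (false , _) p = p
Mpoly (true , _) p = swapPoly p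

-- M_x on block lists (words of 𝔄¹): swapping b,c swaps β_k ↔ γ_k
swapB : Block → Block
swapB (t , m) = (not t , m)

Mblocks : Block → List Block → List Block
Mblocks (false , _) w = w
Mblocks (true , _) w = map swapB w

-- [x,y]: β_{m+n} if x,y of the same kind, γ_{m+n} otherwise
-- (indices: (m+1)+(n+1) = (m+n+1)+1)
bracket : Block → Block → Block
bracket (s , m) (t , n) = (s xor t , suc (m ℕ.+ n))

-- stuffle with fuel; the fuel length u + length v always suffices since
-- every recursive call decreases the total number of blocks
stB : ℕ → List Block → List Block → Poly
stB _ [] v = word (blocksWord v)
stB _ (x ∷ u) [] = word (blocksWord (x ∷ u))
stB zero (x ∷ u) (y ∷ v) = zeroP
stB (suc k) (x ∷ u) (y ∷ v) =
  prefixW (blockWord x) (Mpoly x (stB k (Mblocks x u) (y ∷ v)))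
  ⊕ prefixW (blockWord y) (Mpoly y (stB k (x ∷ u) (Mblocks y v)))
  ⊕ prefixW (blockWord (bracket x y)) (Mpoly (bracket x y) (stB k (Mblocks x u) (Mblocks y v)))

-- stuffle of two words of 𝔄¹ (words outside 𝔄¹ are never used; they give 0)
stW : Word → Word → Poly
stW u v with factor u | factor v
... | just u' | just v' = stB (length u' ℕ.+ length v') u' v'
... | _ | _ = zeroP

infixl 7 _⋆st_
_⋆st_ : Poly → Poly → Poly
_⋆st_ = bilinW stW

lastL : Word → Maybe Letter
lastL [] = nothing
lastL (x ∷ []) = just x
lastL (x ∷ y ∷ w) = lastL (y ∷ w)

starW : Word → Word → Word
starW u (b ∷ v) with lastL u
... | just b = u ++ c ∷ v
... | _ = u ++ b ∷ v
starW u (c ∷ v) with lastL u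
... | just c = u ++ b ∷ v
... | _ = u ++ c ∷ v
starW u v = u ++ v

infixl 7 _✶_
_✶_ : Poly → Poly → Poly
_✶_ = bilinW (λ u v → word (starW u v))

starList : List Poly → Poly
starList [] = one
starList (x ∷ xs) = foldl _✶_ x xs

dP : Poly
dP = word (a ∷ b ∷ []) ⊕ word (a ∷ c ∷ [])

cP : Poly
cP = word (c ∷ [])

isEvenN : ℕ → Bool
isEvenN zero = true
isEvenN (suc k) = not (isEvenN k)

L : ℕ → Poly
L j = if isEvenN j then dP else cP

range : ℕ → ℕ → List ℕ
range i zero = []
range i (suc k) = suc i ∷ range (suc i) k

S : ℕ → ℕ → Poly
S n i = starList (map L (range i (2 ℕ.* n ℕ.∸ i)))

P : ℕ → Poly
P i = if isEvenN i then starList (map L (Data.List.reverse (range 0 i)))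
                   else starList (map L (range 0 i))

Δ : ℕ → ℕ → Poly
Δ n i = (P i ш S n i) ⊖ (P i ⋆st S n i)

-- (-1)^{n-i} = (-1)^{n+i}
sign : ℕ → ℕ → ℚ
sign n i = if isEvenN (n ℕ.+ i) then 1ℚ else Q.- 1ℚ

sumΔ : ℕ → Poly
sumΔ n = concatMap (λ i → scale (sign n i) (Δ n i)) (0 ∷ range 0 (2 ℕ.* n))

lhs : ℕ → Poly
lhs n = scale ((Data.Integer.+ (2 ℕ.^ n)) Q./ 1)
  (word (wpow (a ∷ c ∷ c ∷ a ∷ b ∷ b ∷ []) (n ℕ./ 2) ++ wpow (a ∷ c ∷ c ∷ []) (n ℕ.% 2)))

rhs : ℕ → Poly
rhs n = ppow (word (a ∷ a ∷ b ∷ []) ⊕ word (a ∷ a ∷ c ∷ [])) n ⊕ sumΔ n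

{-# OPTIONS --safe #-}
module Submission where

-- Put E = abc + acb and d = ab + ac.  Evaluating the ⋆-products gives ordinary products:
-- P_{2m} = E^m, P_{2m+1} = c E^m, while S_i is one of 1, c E^k d, E^k d.  For either product ×,
-- put T_n = Σ_{m+k=n} E^m × W_k − Σ_{m+k+1=n} c E^m × E^k d, where W_0 = 1 and W_{k+1} = c E^k d;
-- then (-1)^n T_n is the alternating sum of the P_i × S_i.
-- Unfolding the recursive definitions letter by letter (block by block for the stuffle),
-- almost all terms cancel in T_{n+1}.  What remains is T_{n+1} = −2 acc σ(T_n) for the
-- shuffle and T_{n+1} = −(aab T_n + aac σ(T_n)) for the stuffle, where σ swaps b and c.
-- So the shuffles alone sum to the left-hand side of the theorem, and the stuffles to (a²(b+c))^n.

open import Defs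
open import Data.Nat as ℕ using (ℕ; zero; suc; _≤_)
import Data.Nat.Properties as ℕ
open import Data.Nat.DivMod using (m/n≡1+[m∸n]/n)
import Data.Integer as ℤ
import Data.Integer.Properties as ℤ
open import Data.Bool.Properties using (not-involutive)
open import Data.Rational.Unnormalised as ℚᵘ using (mkℚᵘ)
import Data.Rational.Unnormalised.Properties as ℚᵘ
open import Data.Bool using (true; false; if_then_else_; not)
open import Data.List using (List; []; _∷_; _++_; map; foldl; length; concatMap; reverse)
open import Data.List.Properties using (++-assoc; ++-identityʳ; length-map; map-++; reverse-++)
open import Data.Maybe as Maybe using (Maybe; just; nothing)
open import Data.Product using (_,_)
open import Data.Rational using (ℚ; 0ℚ; 1ℚ; _+_; _*_; -_; _-_)
open import Data.Rational.Properties
open import Data.Rational.Solver using (module +-*-Solver)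
open import Function using (_∘_)
open import Relation.Binary.PropositionalEquality
open ≡-Reasoning
open +-*-Solver using (solve; _:+_; _:*_; :-_; _:-_; _:=_; con)

-- Polynomials are compared by their pairing with arbitrary functions on words; unlike _≈_,
-- this relation is visibly a congruence for all linear and bilinear operations.

ev : Poly → (Word → ℚ) → ℚ
ev [] φ = 0ℚ
ev ((q , u) ∷ p) φ = q * φ u + ev p φ

infix 4 _≃_
_≃_ : Poly → Poly → Set
p ≃ q = ∀ φ → ev p φ ≡ ev q φ

ev-cong : ∀ p {φ ψ} → (∀ u → φ u ≡ ψ u) → ev p φ ≡ ev p ψ
ev-cong [] e = refl
ev-cong ((q , u) ∷ p) e = cong₂ _+_ (cong (q *_) (e u)) (ev-cong p e)

ev-⊕ : ∀ p q φ → ev (p ⊕ q) φ ≡ ev p φ + ev q φ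
ev-⊕ [] q φ = sym (+-identityˡ _)
ev-⊕ ((r , u) ∷ p) q φ =
  trans (cong (r * φ u +_) (ev-⊕ p q φ)) (sym (+-assoc (r * φ u) (ev p φ) (ev q φ)))

ev-scale : ∀ r p φ → ev (scale r p) φ ≡ r * ev p φ
ev-scale r [] φ = sym (*-zeroʳ r)
ev-scale r ((q , u) ∷ p) φ = trans (cong (r * q * φ u +_) (ev-scale r p φ))
  (solve 4 (λ r q x y → r :* q :* x :+ r :* y := r :* (q :* x :+ y)) refl r q (φ u) (ev p φ))

ev-prefix : ∀ x p φ → ev (prefixW x p) φ ≡ ev p (φ ∘ (x ++_))
ev-prefix x [] φ = refl
ev-prefix x ((q , u) ∷ p) φ = cong (q * φ (x ++ u) +_) (ev-prefix x p φ)

ev-swap : ∀ p φ → ev (swapPoly p) φ ≡ ev p (φ ∘ map swapL)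
ev-swap [] φ = refl
ev-swap ((q , u) ∷ p) φ = cong (q * φ (map swapL u) +_) (ev-swap p φ)

ev-word : ∀ w φ → ev (word w) φ ≡ φ w
ev-word w φ = trans (+-identityʳ _) (*-identityˡ _)

ev-+ : ∀ p φ ψ → ev p (λ u → φ u + ψ u) ≡ ev p φ + ev p ψ
ev-+ [] φ ψ = refl
ev-+ ((q , u) ∷ p) φ ψ = trans (cong (q * (φ u + ψ u) +_) (ev-+ p φ ψ))
  (solve 5 (λ q x y z w → q :* (x :+ y) :+ (z :+ w) := q :* x :+ z :+ (q :* y :+ w))
    refl q (φ u) (ψ u) (ev p φ) (ev p ψ))

ev₂ : Poly → Poly → (Word → Word → ℚ) → ℚ
ev₂ p q g = ev p (λ u → ev q (g u))

ev₂-cong : ∀ p q {f g} → (∀ u v → f u v ≡ g u v) → ev₂ p q f ≡ ev₂ p q g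
ev₂-cong p q e = ev-cong p (λ u → ev-cong q (e u))

ev₂-+ : ∀ p q f g → ev₂ p q (λ u v → f u v + g u v) ≡ ev₂ p q f + ev₂ p q g
ev₂-+ p q f g = trans (ev-cong p (λ u → ev-+ q (f u) (g u))) (ev-+ p _ _)

ev-bilin : ∀ f p q φ → ev (bilinW f p q) φ ≡ ev₂ p q (λ u v → ev (f u v) φ)
ev-bilin f [] q φ = refl
ev-bilin f ((r , u) ∷ p) q φ = trans (ev-⊕ (row q) (bilinW f p q) φ)
  (cong₂ _+_ (ev-row q) (ev-bilin f p q φ))
  where
  row : Poly → Poly
  row = concatMap (λ { (s , v) → scale (r * s) (f u v) })
  ev-row : ∀ q → ev (row q) φ ≡ r * ev q (λ v → ev (f u v) φ)
  ev-row [] = sym (*-zeroʳ r)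
  ev-row ((s , v) ∷ q) = trans (ev-⊕ (scale (r * s) (f u v)) (row q) φ)
    (trans (cong₂ _+_ (ev-scale (r * s) (f u v) φ) (ev-row q))
      (solve 4 (λ r s x y → r :* s :* x :+ r :* y := r :* (s :* x :+ y))
        refl r s (ev (f u v) φ) (ev q (λ v → ev (f u v) φ))))

ev-· : ∀ p q φ → ev (p · q) φ ≡ ev₂ p q (λ u v → φ (u ++ v))
ev-· [] q φ = refl
ev-· ((r , u) ∷ p) q φ = trans (ev-⊕ (row q) (p · q) φ) (cong₂ _+_ (ev-row q) (ev-· p q φ))
  where
  row : Poly → Poly
  row = map (λ { (s , v) → (r * s , u ++ v) })
  ev-row : ∀ q → ev (row q) φ ≡ r * ev q (λ v → φ (u ++ v))
  ev-row [] = sym (*-zeroʳ r)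
  ev-row ((s , v) ∷ q) = trans (cong (r * s * φ (u ++ v) +_) (ev-row q))
      (solve 4 (λ r s x y → r :* s :* x :+ r :* y := r :* (s :* x :+ y))
        refl r s (φ (u ++ v)) (ev q (λ v → φ (u ++ v))))

indicator : Word → Word → ℚ
indicator w u = if u ==W w then 1ℚ else 0ℚ

-- Pairing with an indicator leads from `_≃_` back to the equality `_≈_` of the theorem.
coeff-ev : ∀ p w → coeff p w ≡ ev p (indicator w)
coeff-ev [] w = refl
coeff-ev ((q , u) ∷ p) w with u ==W w
... | true = cong₂ _+_ (sym (*-identityʳ q)) (coeff-ev p w)
... | false = trans (coeff-ev p w)
  (sym (trans (cong (_+ ev p (indicator w)) (*-zeroʳ q)) (+-identityˡ _)))

≃⇒≈ : ∀ {p q} → p ≃ q → p ≈ q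
≃⇒≈ {p} {q} e w = trans (coeff-ev p w) (trans (e (indicator w)) (sym (coeff-ev q w)))

-- Bilinear products

module Product (f : Word → Word → Poly) where

  -- By `ev-bilin` this is `ev (bilinW f p q) φ`. Each factor enters only through `ev`, so
  -- congruence and additivity are immediate and products are never expanded as lists.
  pr : Poly → Poly → (Word → ℚ) → ℚ
  pr p q φ = ev₂ p q (λ u v → ev (f u v) φ)

  pr-congˡ : ∀ p p' q φ → p ≃ p' → pr p q φ ≡ pr p' q φ
  pr-congˡ p p' q φ e = e _

  pr-congʳ : ∀ p q q' φ → q ≃ q' → pr p q φ ≡ pr p q' φ
  pr-congʳ p q q' φ e = ev-cong p (λ u → e _)

  pr-⊕ˡ : ∀ p p' q φ → pr (p ⊕ p') q φ ≡ pr p q φ + pr p' q φ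
  pr-⊕ˡ p p' q φ = ev-⊕ p p' _

  pr-⊕ʳ : ∀ p q q' φ → pr p (q ⊕ q') φ ≡ pr p q φ + pr p q' φ
  pr-⊕ʳ p q q' φ = trans (ev-cong p (λ u → ev-⊕ q q' _)) (ev-+ p _ _)

  pr-prefix : ∀ x y p q φ →
    pr (prefixW x p) (prefixW y q) φ ≡ ev₂ p q (λ u v → ev (f (x ++ u) (y ++ v)) φ)
  pr-prefix x y p q φ = trans (ev-prefix x p _) (ev-cong p (λ u → ev-prefix y q _))

  pr-oneʳ : ∀ p φ → pr p one φ ≡ ev p (λ u → ev (f u []) φ)
  pr-oneʳ p φ = ev-cong p (λ u → ev-word [] (λ v → ev (f u v) φ))

  pr-oneˡ : ∀ q φ → pr one q φ ≡ ev q (λ v → ev (f [] v) φ)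
  pr-oneˡ q φ = ev-word [] (λ u → ev q (λ v → ev (f u v) φ))

open Product shW using () renaming
  (pr to sh; pr-congˡ to sh-congˡ; pr-congʳ to sh-congʳ; pr-⊕ˡ to sh-⊕ˡ; pr-⊕ʳ to sh-⊕ʳ;
   pr-prefix to sh-prefix; pr-oneˡ to sh-oneˡ; pr-oneʳ to sh-oneʳ)
open Product stW using () renaming
  (pr to st; pr-congˡ to st-congˡ; pr-congʳ to st-congʳ; pr-⊕ˡ to st-⊕ˡ; pr-⊕ʳ to st-⊕ʳ;
   pr-prefix to st-prefix; pr-oneˡ to st-oneˡ; pr-oneʳ to st-oneʳ)

-- First-letter recursion for the shuffle of polynomials

infixr 8 _◂_
_◂_ : Letter → Poly → Poly
x ◂ p = prefixW (x ∷ []) p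

ev-◂ : ∀ x p φ → ev (x ◂ p) φ ≡ ev p (φ ∘ (x ∷_))
ev-◂ x = ev-prefix (x ∷ [])

shW-[]ʳ : ∀ u φ → ev (shW u []) φ ≡ φ u
shW-[]ʳ [] φ = ev-word [] φ
shW-[]ʳ (x ∷ u) φ = ev-word (x ∷ u) φ

-- Boundary case of the recursion. As everywhere below, an emitted letter is stored by precomposing
-- the test function with it.
sh-peelˡ : ∀ x p φ → sh (x ◂ p) one φ ≡ sh p one (φ ∘ (x ∷_))
sh-peelˡ x p φ = begin
  sh (x ◂ p) one φ                    ≡⟨ sh-oneʳ (x ◂ p) φ ⟩
  ev (x ◂ p) (λ u → ev (shW u []) φ)  ≡⟨ ev-◂ x p _ ⟩
  ev p (λ u → ev (shW (x ∷ u) []) φ)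
    ≡⟨ ev-cong p (λ u → trans (shW-[]ʳ (x ∷ u) φ) (sym (shW-[]ʳ u _))) ⟩
  ev p (λ u → ev (shW u []) (φ ∘ (x ∷_))) ≡⟨ sym (sh-oneʳ p (φ ∘ (x ∷_))) ⟩
  sh p one (φ ∘ (x ∷_)) ∎

sh-peelʳ : ∀ y q φ → sh one (y ◂ q) φ ≡ sh one q (φ ∘ (y ∷_))
sh-peelʳ y q φ = begin
  sh one (y ◂ q) φ               ≡⟨ sh-oneˡ (y ◂ q) φ ⟩
  ev (y ◂ q) (λ v → ev (word v) φ)  ≡⟨ ev-◂ y q _ ⟩
  ev q (λ v → ev (word (y ∷ v)) φ)  ≡⟨⟩
  ev q (λ v → ev (word v) (φ ∘ (y ∷_))) ≡⟨ sym (sh-oneˡ q (φ ∘ (y ∷_))) ⟩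
  sh one q (φ ∘ (y ∷_)) ∎

sh-peel : ∀ x y p q φ →
  sh (x ◂ p) (y ◂ q) φ ≡ sh p (y ◂ q) (φ ∘ (x ∷_)) + sh (x ◂ p) q (φ ∘ (y ∷_))
sh-peel x y p q φ = begin
  sh (x ◂ p) (y ◂ q) φ ≡⟨ sh-prefix (x ∷ []) (y ∷ []) p q φ ⟩
  ev₂ p q (λ u v → ev (shW (x ∷ u) (y ∷ v)) φ)
    ≡⟨ ev₂-cong p q (λ u v → trans (ev-⊕ (x ◂ shW u (y ∷ v)) (y ◂ shW (x ∷ u) v) φ)
         (cong₂ _+_ (ev-◂ x (shW u (y ∷ v)) φ) (ev-◂ y (shW (x ∷ u) v) φ))) ⟩
  ev₂ p q (λ u v → ev (shW u (y ∷ v)) (φ ∘ (x ∷_)) + ev (shW (x ∷ u) v) (φ ∘ (y ∷_)))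
    ≡⟨ ev₂-+ p q _ _ ⟩
  ev₂ p q (λ u v → ev (shW u (y ∷ v)) (φ ∘ (x ∷_)))
    + ev₂ p q (λ u v → ev (shW (x ∷ u) v) (φ ∘ (y ∷_)))
    ≡⟨ cong₂ _+_ (ev-cong p (λ u → sym (ev-◂ y q _))) (sym (ev-◂ x p _)) ⟩
  sh p (y ◂ q) (φ ∘ (x ∷_)) + sh (x ◂ p) q (φ ∘ (y ∷_)) ∎

-- The stuffle recursion at the level of words

M : Block → Word → Word
M (false , _) w = w
M (true , _) w = map swapL w

infixr 8 _◃_
_◃_ : Block → Poly → Poly
x ◃ p = prefixW (blockWord x) p

infixl 9 _∘M_
_∘M_ : (Word → ℚ) → Block → Word → ℚ
-- The map w ↦ x M_x(w), transposed to test functions: emitting a block and twisting the rest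
-- becomes a change of `φ`.
(φ ∘M x) w = φ (blockWord x ++ M x w)

ev-Mpoly : ∀ x p φ → ev (Mpoly x p) φ ≡ ev p (φ ∘ M x)
ev-Mpoly (false , _) p φ = refl
ev-Mpoly (true , _) p φ = ev-swap p φ

ev-◃M : ∀ x p φ → ev (x ◃ Mpoly x p) φ ≡ ev p (φ ∘M x)
ev-◃M x p φ = trans (ev-prefix (blockWord x) (Mpoly x p) φ) (ev-Mpoly x p _)

factorAux-a : ∀ i m w → factorAux i (wpow (a ∷ []) m ++ w) ≡ factorAux (m ℕ.+ i) w
factorAux-a i zero w = refl
factorAux-a zero (suc m) w = trans (factorAux-a 1 m w) (cong (λ j → factorAux j w) (ℕ.+-suc m 0))
factorAux-a (suc i) (suc m) w =
  trans (factorAux-a (suc (suc i)) m w) (cong (λ j → factorAux j w) (ℕ.+-suc m (suc i)))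

factorAux-b : ∀ m w → factorAux m (b ∷ w) ≡ Maybe.map ((false , m) ∷_) (factor w)
factorAux-b zero w = refl
factorAux-b (suc m) w = refl

factorAux-c : ∀ m w → factorAux m (c ∷ w) ≡ Maybe.map ((true , m) ∷_) (factor w)
factorAux-c zero w = refl
factorAux-c (suc m) w = refl

factor-block : ∀ x w → factor (blockWord x ++ w) ≡ Maybe.map (x ∷_) (factor w)
factor-block (false , m) w
  rewrite ++-assoc (wpow (a ∷ []) m) (b ∷ []) w
        | factorAux-a 0 m (b ∷ w) | ℕ.+-identityʳ m = factorAux-b m w
factor-block (true , m) w
  rewrite ++-assoc (wpow (a ∷ []) m) (c ∷ []) w
        | factorAux-a 0 m (c ∷ w) | ℕ.+-identityʳ m = factorAux-c m w

factorAux-swap : ∀ m w → factorAux m (map swapL w) ≡ Maybe.map (map swapB) (factorAux m w)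
factorAux-swap zero [] = refl
factorAux-swap (suc m) [] = refl
factorAux-swap zero (a ∷ w) = factorAux-swap 1 w
factorAux-swap (suc m) (a ∷ w) = factorAux-swap (suc (suc m)) w
factorAux-swap m (b ∷ w)
  rewrite factorAux-b m w | factorAux-c m (map swapL w) | factorAux-swap 0 w with factor w
... | just _ = refl
... | nothing = refl
factorAux-swap m (c ∷ w)
  rewrite factorAux-c m w | factorAux-b m (map swapL w) | factorAux-swap 0 w with factor w
... | just _ = refl
... | nothing = refl

factor-M : ∀ x w → factor (M x w) ≡ Maybe.map (Mblocks x) (factor w)
factor-M (false , _) w with factor w
... | just _ = refl
... | nothing = refl
factor-M (true , _) w = factorAux-swap 0 w

length-Mblocks : ∀ x u → length (Mblocks x u) ≡ length u
length-Mblocks (false , _) u = refl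
length-Mblocks (true , _) u = length-map swapB u

-- Every call consumes at least one block and `Mblocks` preserves length, so sufficient fuel never
-- runs out.
stB-fuel : ∀ k l u v → length u ℕ.+ length v ≤ k → length u ℕ.+ length v ≤ l →
  stB k u v ≡ stB l u v
stB-fuel k l [] v _ _ = refl
stB-fuel k l (x ∷ u) [] _ _ = refl
stB-fuel (suc k) (suc l) (x ∷ u) (y ∷ v) (ℕ.s≤s h) (ℕ.s≤s h') =
  cong₂ _⊕_ (cong₂ _⊕_
    (cong (λ p → x ◃ Mpoly x p) (stB-fuel k l (Mblocks x u) (y ∷ v) (left h) (left h')))
    (cong (λ p → y ◃ Mpoly y p) (stB-fuel k l (x ∷ u) (Mblocks y v) (right h) (right h'))))
    (cong (λ p → bracket x y ◃ Mpoly (bracket x y) p)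
      (stB-fuel k l (Mblocks x u) (Mblocks y v) (both h) (both h')))
  where
  left : ∀ {k} → length u ℕ.+ suc (length v) ≤ k → length (Mblocks x u) ℕ.+ suc (length v) ≤ k
  left h rewrite length-Mblocks x u = h
  right : ∀ {k} → length u ℕ.+ suc (length v) ≤ k → suc (length u ℕ.+ length (Mblocks y v)) ≤ k
  right h rewrite length-Mblocks y v | ℕ.+-suc (length u) (length v) = h
  both : ∀ {k} → length u ℕ.+ suc (length v) ≤ k → length (Mblocks x u) ℕ.+ length (Mblocks y v) ≤ k
  both h rewrite length-Mblocks x u | length-Mblocks y v | ℕ.+-suc (length u) (length v) =
    ℕ.≤-trans (ℕ.n≤1+n _) h

-- `stW` with the factorisations as arguments, so that prefixing a block becomes `Maybe.map (x ∷_)`.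
-- A failed factorisation gives zero on both sides of each recursion, which therefore holds for all
-- words.
stM : Maybe (List Block) → Maybe (List Block) → Poly
stM (just u) (just v) = stB (length u ℕ.+ length v) u v
stM _ _ = zeroP

stW-stM : ∀ u v → stW u v ≡ stM (factor u) (factor v)
stW-stM u v with factor u | factor v
... | just _  | just _  = refl
... | just _  | nothing = refl
... | nothing | _       = refl

M-blocks : ∀ x u → M x (blocksWord (Mblocks x u)) ≡ blocksWord u
M-blocks (false , _) u = refl
M-blocks (true , _) u = swap-blocks u
  where
  swap-a : ∀ m w → map swapL (wpow (a ∷ []) m ++ w) ≡ wpow (a ∷ []) m ++ map swapL w
  swap-a zero w = refl
  swap-a (suc m) w = cong (a ∷_) (swap-a m w)
  swap-block : ∀ x → map swapL (blockWord (swapB x)) ≡ blockWord x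
  swap-block (false , m) = swap-a m (c ∷ [])
  swap-block (true , m) = swap-a m (b ∷ [])
  swap-blocks : ∀ u → map swapL (blocksWord (map swapB u)) ≡ blocksWord u
  swap-blocks [] = refl
  swap-blocks (x ∷ u) = trans (map-++ swapL (blockWord (swapB x)) (blocksWord (map swapB u)))
    (cong₂ _++_ (swap-block x) (swap-blocks u))

stM-[]ʳ : ∀ u φ → ev (stM (just u) (just [])) φ ≡ φ (blocksWord u)
stM-[]ʳ [] φ = ev-word [] φ
stM-[]ʳ (x ∷ u) φ = ev-word (blocksWord (x ∷ u)) φ

-- The product with the empty word does not recurse, but M_x is an involution, so x w = x M_x(M_x w)
-- has the same twisted form as the terms of the recursion.
stM-peelˡ : ∀ x u φ → ev (stM (Maybe.map (x ∷_) u) (just [])) φ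
  ≡ ev (stM (Maybe.map (Mblocks x) u) (just [])) (φ ∘M x)
stM-peelˡ x nothing φ = refl
stM-peelˡ x (just u) φ = begin
  ev (stM (just (x ∷ u)) (just [])) φ  ≡⟨ stM-[]ʳ (x ∷ u) φ ⟩
  φ (blockWord x ++ blocksWord u)      ≡⟨ cong (φ ∘ (blockWord x ++_)) (sym (M-blocks x u)) ⟩
  (φ ∘M x) (blocksWord (Mblocks x u))  ≡⟨ sym (stM-[]ʳ (Mblocks x u) (φ ∘M x)) ⟩
  ev (stM (just (Mblocks x u)) (just [])) (φ ∘M x) ∎

stM-peelʳ : ∀ y v φ → ev (stM (just []) (Maybe.map (y ∷_) v)) φ
  ≡ ev (stM (just []) (Maybe.map (Mblocks y) v)) (φ ∘M y)
stM-peelʳ y nothing φ = refl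
stM-peelʳ y (just v) φ = begin
  ev (word (blocksWord (y ∷ v))) φ     ≡⟨ ev-word (blocksWord (y ∷ v)) φ ⟩
  φ (blockWord y ++ blocksWord v)      ≡⟨ cong (φ ∘ (blockWord y ++_)) (sym (M-blocks y v)) ⟩
  (φ ∘M y) (blocksWord (Mblocks y v))  ≡⟨ sym (ev-word (blocksWord (Mblocks y v)) (φ ∘M y)) ⟩
  ev (word (blocksWord (Mblocks y v))) (φ ∘M y) ∎

stM-peel : ∀ x y u v φ → ev (stM (Maybe.map (x ∷_) u) (Maybe.map (y ∷_) v)) φ
  ≡ ev (stM (Maybe.map (Mblocks x) u) (Maybe.map (y ∷_) v)) (φ ∘M x)
  + ev (stM (Maybe.map (x ∷_) u) (Maybe.map (Mblocks y) v)) (φ ∘M y)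
  + ev (stM (Maybe.map (Mblocks x) u) (Maybe.map (Mblocks y) v)) (φ ∘M bracket x y)
stM-peel x y nothing nothing φ = refl
stM-peel x y nothing (just v) φ = refl
stM-peel x y (just u) nothing φ = refl
stM-peel x y (just u) (just v) φ = begin
  ev (x ◃ Mpoly x p ⊕ y ◃ Mpoly y q ⊕ z ◃ Mpoly z r) φ
    ≡⟨ trans (ev-⊕ (x ◃ Mpoly x p ⊕ y ◃ Mpoly y q) _ φ) (cong₂ _+_ (ev-⊕ (x ◃ Mpoly x p) _ φ) refl) ⟩
  ev (x ◃ Mpoly x p) φ + ev (y ◃ Mpoly y q) φ + ev (z ◃ Mpoly z r) φ
    ≡⟨ cong₂ _+_ (cong₂ _+_ (ev-◃M x p φ) (ev-◃M y q φ)) (ev-◃M z r φ) ⟩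
  ev p (φ ∘M x) + ev q (φ ∘M y) + ev r (φ ∘M z)
    ≡⟨ cong₂ _+_ (cong₂ _+_ (cong (λ p → ev p (φ ∘M x)) fuelˡ) (cong (λ q → ev q (φ ∘M y)) fuelʳ))
         (cong (λ r → ev r (φ ∘M z)) fuel) ⟩
  ev (stM (just (Mblocks x u)) (just (y ∷ v))) (φ ∘M x)
    + ev (stM (just (x ∷ u)) (just (Mblocks y v))) (φ ∘M y)
    + ev (stM (just (Mblocks x u)) (just (Mblocks y v))) (φ ∘M z) ∎
  where
  z = bracket x y
  k = length u ℕ.+ suc (length v)
  p = stB k (Mblocks x u) (y ∷ v)
  q = stB k (x ∷ u) (Mblocks y v)
  r = stB k (Mblocks x u) (Mblocks y v)
  fuelˡ : p ≡ stM (just (Mblocks x u)) (just (y ∷ v))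
  fuelˡ = cong (λ l → stB (l ℕ.+ suc (length v)) (Mblocks x u) (y ∷ v)) (sym (length-Mblocks x u))
  fuelʳ : q ≡ stM (just (x ∷ u)) (just (Mblocks y v))
  fuelʳ = cong (λ l → stB l (x ∷ u) (Mblocks y v))
    (trans (ℕ.+-suc (length u) (length v)) (cong (λ l → suc (length u ℕ.+ l)) (sym (length-Mblocks y v))))
  fuel : r ≡ stM (just (Mblocks x u)) (just (Mblocks y v))
  -- Both factors have lost a block, so `k` exceeds the block count by one; the other two calls get
  -- exactly the fuel that `stM` supplies.
  fuel = stB-fuel k _ (Mblocks x u) (Mblocks y v)
    (subst₂ (λ i j → i ℕ.+ j ≤ k) (sym (length-Mblocks x u)) (sym (length-Mblocks y v))
      (ℕ.+-monoʳ-≤ (length u) (ℕ.n≤1+n (length v))))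
    ℕ.≤-refl

stW-factor : ∀ u v {u' v'} φ → factor u ≡ u' → factor v ≡ v' → ev (stW u v) φ ≡ ev (stM u' v') φ
stW-factor u v φ refl refl = cong (λ p → ev p φ) (stW-stM u v)

stW-peelˡ : ∀ x u φ → ev (stW (blockWord x ++ u) []) φ ≡ ev (stW (M x u) []) (φ ∘M x)
stW-peelˡ x u φ = begin
  _ ≡⟨ stW-factor (blockWord x ++ u) [] φ (factor-block x u) refl ⟩
  _ ≡⟨ stM-peelˡ x (factor u) φ ⟩
  _ ≡⟨ sym (stW-factor (M x u) [] (φ ∘M x) (factor-M x u) refl) ⟩
  _ ∎

stW-peelʳ : ∀ y v φ → ev (stW [] (blockWord y ++ v)) φ ≡ ev (stW [] (M y v)) (φ ∘M y)
stW-peelʳ y v φ = begin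
  _ ≡⟨ stW-factor [] (blockWord y ++ v) φ refl (factor-block y v) ⟩
  _ ≡⟨ stM-peelʳ y (factor v) φ ⟩
  _ ≡⟨ sym (stW-factor [] (M y v) (φ ∘M y) refl (factor-M y v)) ⟩
  _ ∎

-- `factor` commutes with prefixing a block and with the twist, so the recursion on block lists
-- becomes one on words, ready for bilinear extension.
stW-peel : ∀ x y u v φ → ev (stW (blockWord x ++ u) (blockWord y ++ v)) φ
  ≡ ev (stW (M x u) (blockWord y ++ v)) (φ ∘M x)
  + ev (stW (blockWord x ++ u) (M y v)) (φ ∘M y)
  + ev (stW (M x u) (M y v)) (φ ∘M bracket x y)
stW-peel x y u v φ = begin
  _ ≡⟨ stW-factor (blockWord x ++ u) (blockWord y ++ v) φ (factor-block x u) (factor-block y v) ⟩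
  _ ≡⟨ stM-peel x y (factor u) (factor v) φ ⟩
  _ ≡⟨ sym (cong₂ _+_ (cong₂ _+_
         (stW-factor (M x u) (blockWord y ++ v) (φ ∘M x) (factor-M x u) (factor-block y v))
         (stW-factor (blockWord x ++ u) (M y v) (φ ∘M y) (factor-block x u) (factor-M y v)))
         (stW-factor (M x u) (M y v) (φ ∘M bracket x y) (factor-M x u) (factor-M y v))) ⟩
  _ ∎

st-peelˡ : ∀ x p φ → st (x ◃ p) one φ ≡ st (Mpoly x p) one (φ ∘M x)
st-peelˡ x p φ = begin
  st (x ◃ p) one φ ≡⟨ trans (st-oneʳ (x ◃ p) φ) (ev-prefix (blockWord x) p _) ⟩
  ev p (λ u → ev (stW (blockWord x ++ u) []) φ) ≡⟨ ev-cong p (λ u → stW-peelˡ x u φ) ⟩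
  ev p (λ u → ev (stW (M x u) []) (φ ∘M x))
    ≡⟨ sym (trans (st-oneʳ (Mpoly x p) (φ ∘M x)) (ev-Mpoly x p _)) ⟩
  st (Mpoly x p) one (φ ∘M x) ∎

st-peelʳ : ∀ y q φ → st one (y ◃ q) φ ≡ st one (Mpoly y q) (φ ∘M y)
st-peelʳ y q φ = begin
  st one (y ◃ q) φ ≡⟨ trans (st-oneˡ (y ◃ q) φ) (ev-prefix (blockWord y) q _) ⟩
  ev q (λ v → ev (stW [] (blockWord y ++ v)) φ) ≡⟨ ev-cong q (λ v → stW-peelʳ y v φ) ⟩
  ev q (λ v → ev (stW [] (M y v)) (φ ∘M y))
    ≡⟨ sym (trans (st-oneˡ (Mpoly y q) (φ ∘M y)) (ev-Mpoly y q _)) ⟩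
  st one (Mpoly y q) (φ ∘M y) ∎

st-peel : ∀ x y p q φ → st (x ◃ p) (y ◃ q) φ
  ≡ st (Mpoly x p) (y ◃ q) (φ ∘M x) + st (x ◃ p) (Mpoly y q) (φ ∘M y)
  + st (Mpoly x p) (Mpoly y q) (φ ∘M bracket x y)
st-peel x y p q φ = begin
  st (x ◃ p) (y ◃ q) φ ≡⟨ st-prefix (blockWord x) (blockWord y) p q φ ⟩
  ev₂ p q (λ u v → ev (stW (blockWord x ++ u) (blockWord y ++ v)) φ)
    ≡⟨ ev₂-cong p q (λ u v → stW-peel x y u v φ) ⟩
  ev₂ p q (λ u v → ev (stW (M x u) (blockWord y ++ v)) (φ ∘M x)
    + ev (stW (blockWord x ++ u) (M y v)) (φ ∘M y)
    + ev (stW (M x u) (M y v)) (φ ∘M bracket x y))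
    ≡⟨ trans (ev₂-+ p q _ _) (cong₂ _+_ (ev₂-+ p q _ _) refl) ⟩
  ev₂ p q (λ u v → ev (stW (M x u) (blockWord y ++ v)) (φ ∘M x))
    + ev₂ p q (λ u v → ev (stW (blockWord x ++ u) (M y v)) (φ ∘M y))
    + ev₂ p q (λ u v → ev (stW (M x u) (M y v)) (φ ∘M bracket x y))
    ≡⟨ sym (cong₂ _+_ (cong₂ _+_
         (trans (ev-Mpoly x p _) (ev-cong p (λ u → ev-prefix (blockWord y) q _)))
         (trans (ev-prefix (blockWord x) p _) (ev-cong p (λ u → ev-Mpoly y q _))))
         (trans (ev-Mpoly x p _) (ev-cong p (λ u → ev-Mpoly y q _)))) ⟩
  st (Mpoly x p) (y ◃ q) (φ ∘M x) + st (x ◃ p) (Mpoly y q) (φ ∘M y)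
    + st (Mpoly x p) (Mpoly y q) (φ ∘M bracket x y) ∎

-- For {y , z} = {b , c}, the polynomials E y z m, V y z m and W y z m are the m-th terms of
-- the sequences E^m, E^m d and 1, z d, z E d, z E² d, …

E F W V R : Letter → Letter → ℕ → Poly
E y z zero = one
E y z (suc m) = a ◂ F y z m
F y z m = (y ◂ z ◂ E y z m) ⊕ (z ◂ y ◂ E y z m)
W y z zero = one
W y z (suc k) = z ◂ V y z k
V y z k = a ◂ R y z k
-- The effect of ⋆: after `y` the word resumes with `z`, as in `W y z`, and after `z` with `y`.
R y z k = (y ◂ W y z k) ⊕ (z ◂ W z y k)

ev-◂⊕◂ : ∀ x p y q φ → ev ((x ◂ p) ⊕ (y ◂ q)) φ ≡ ev p (φ ∘ (x ∷_)) + ev q (φ ∘ (y ∷_))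
ev-◂⊕◂ x p y q φ = trans (ev-⊕ (x ◂ p) (y ◂ q) φ) (cong₂ _+_ (ev-◂ x p φ) (ev-◂ y q φ))

ev-E : ∀ y z m φ → ev (E y z (suc m)) φ
  ≡ ev (z ◂ E y z m) (φ ∘ (λ u → a ∷ y ∷ u)) + ev (y ◂ E y z m) (φ ∘ (λ u → a ∷ z ∷ u))
ev-E y z m φ = trans (ev-◂ a (F y z m) φ) (ev-◂⊕◂ y (z ◂ E y z m) z (y ◂ E y z m) _)

ev-V : ∀ y z k φ → ev (V y z k) φ
  ≡ ev (W y z k) (φ ∘ (λ u → a ∷ y ∷ u)) + ev (W z y k) (φ ∘ (λ u → a ∷ z ∷ u))
ev-V y z k φ = trans (ev-◂ a (R y z k) φ) (ev-◂⊕◂ y (W y z k) z (W z y k) _)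

◂-cong : ∀ x p q → p ≃ q → x ◂ p ≃ x ◂ q
◂-cong x p q e φ = trans (ev-◂ x p φ) (trans (e _) (sym (ev-◂ x q φ)))

-- With `V-sym`, this recognises the terms left by the recursions, in which the letters have traded
-- roles. `W` lacks the symmetry, its first letter being distinguished.
E-sym : ∀ y z m → E y z m ≃ E z y m
E-sym y z zero φ = refl
E-sym y z (suc m) φ = begin
  ev (E y z (suc m)) φ ≡⟨ ev-E y z m φ ⟩
  _ ≡⟨ cong₂ _+_ (◂-cong z (E y z m) (E z y m) (E-sym y z m) φy)
                 (◂-cong y (E y z m) (E z y m) (E-sym y z m) φz) ⟩
  _ ≡⟨ +-comm (ev (z ◂ E z y m) φy) (ev (y ◂ E z y m) φz) ⟩
  _ ≡⟨ sym (ev-E z y m φ) ⟩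
  ev (E z y (suc m)) φ ∎
  where
  φy = φ ∘ (λ u → a ∷ y ∷ u)
  φz = φ ∘ (λ u → a ∷ z ∷ u)

V-sym : ∀ y z k → V y z k ≃ V z y k
V-sym y z k φ = trans (ev-V y z k φ)
  (trans (+-comm (ev (W y z k) _) _) (sym (ev-V z y k φ)))

-- tri f 0 n is the sum of f m k over m + k + 1 = n.
tri : (ℕ → ℕ → ℚ) → ℕ → ℕ → ℚ
tri f m zero = 0ℚ
tri f m (suc k) = f m k + tri f (suc m) k

-- Zero padding makes a peeling identity uniform in `m` and `k` when one of its terms is missing for
-- an empty factor. The padded sum over an antidiagonal is the unpadded sum over the next shorter
-- one.
shiftˡ shiftʳ : (ℕ → ℕ → ℚ) → ℕ → ℕ → ℚ
shiftˡ f zero k = 0ℚ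
shiftˡ f (suc m) k = f m k
shiftʳ f m zero = 0ℚ
shiftʳ f m (suc k) = f m k

tri-cong : ∀ {f g} → (∀ m k → f m k ≡ g m k) → ∀ m n → tri f m n ≡ tri g m n
tri-cong e m zero = refl
tri-cong e m (suc n) = cong₂ _+_ (e m n) (tri-cong e (suc m) n)

tri-+ : ∀ f g m n → tri (λ i j → f i j + g i j) m n ≡ tri f m n + tri g m n
tri-+ f g m zero = refl
tri-+ f g m (suc n) = trans (cong (f m n + g m n +_) (tri-+ f g (suc m) n))
  (solve 4 (λ x y z w → x :+ y :+ (z :+ w) := x :+ z :+ (y :+ w)) refl
    (f m n) (g m n) (tri f (suc m) n) (tri g (suc m) n))

tri-split : ∀ {f} g h → (∀ i j → f i j ≡ g i j + h i j) → ∀ m n →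
  tri f m n ≡ tri g m n + tri h m n
tri-split g h e m n = trans (tri-cong e m n) (tri-+ g h m n)

tri-split₃ : ∀ {f} g h k → (∀ i j → f i j ≡ g i j + h i j + k i j) → ∀ m n →
  tri f m n ≡ tri g m n + tri h m n + tri k m n
tri-split₃ g h k e m n = trans (tri-split (λ i j → g i j + h i j) k e m n)
  (cong (_+ tri k m n) (tri-+ g h m n))

tri-suc : ∀ f m n → tri f (suc m) n ≡ tri (f ∘ suc) m n
tri-suc f m zero = refl
tri-suc f m (suc n) = cong (f (suc m) n +_) (tri-suc f (suc m) n)

tri-shiftˡ : ∀ f n → tri (shiftˡ f) 0 (suc n) ≡ tri f 0 n
tri-shiftˡ f n = trans (+-identityˡ _) (tri-suc (shiftˡ f) 0 n)

tri-shiftʳ : ∀ f m n → tri (shiftʳ f) m (suc n) ≡ tri f m n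
tri-shiftʳ f m zero = refl
tri-shiftʳ f m (suc n) = cong (f m n +_) (tri-shiftʳ f (suc m) n)

tri-splitʳ : ∀ {f} g h → (∀ i j → f i j ≡ g i j + shiftʳ h i j) → ∀ n →
  tri f 0 (suc n) ≡ tri g 0 (suc n) + tri h 0 n
tri-splitʳ g h e n = trans (tri-split g (shiftʳ h) e 0 (suc n))
  (cong (tri g 0 (suc n) +_) (tri-shiftʳ h 0 n))

-- Nonempty left factors supply `p`, nonempty right factors supply `q`, and each family reindexes to
-- the next shorter antidiagonal. The indices add up to at least 1, so the factors are never both
-- empty.
tri-peel : ∀ f p q → (∀ m → f (suc m) 0 ≡ p m 0) → (∀ k → f 0 (suc k) ≡ q 0 k) →
  (∀ m k → f (suc m) (suc k) ≡ p m (suc k) + q (suc m) k) →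
  ∀ n → tri f 0 (suc (suc n)) ≡ tri p 0 (suc n) + tri q 0 (suc n)
tri-peel f p q e₁₀ e₀₁ e₁₁ n = begin
  f 0 (suc n) + tri f 1 (suc n)
    ≡⟨ cong₂ _+_ (e₀₁ n) (trans (tri-suc f 0 (suc n)) (tri-splitʳ p (q ∘ suc) step n)) ⟩
  q 0 n + (tri p 0 (suc n) + tri (q ∘ suc) 0 n)
    ≡⟨ solve 3 (λ x y z → x :+ (y :+ z) := y :+ (x :+ z)) refl (q 0 n) (tri p 0 (suc n)) _ ⟩
  tri p 0 (suc n) + (q 0 n + tri (q ∘ suc) 0 n)
    ≡⟨ cong (λ t → tri p 0 (suc n) + (q 0 n + t)) (sym (tri-suc q 0 n)) ⟩
  tri p 0 (suc n) + tri q 0 (suc n) ∎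
  where
  step : ∀ m k → f (suc m) k ≡ p m k + shiftʳ (q ∘ suc) m k
  step m zero = trans (e₁₀ m) (sym (+-identityʳ _))
  step m (suc k) = e₁₁ m k

-- The T_n of the header, for the product pr.

alternating : (Poly → Poly → (Word → ℚ) → ℚ) → Letter → Letter → ℕ → (Word → ℚ) → ℚ
alternating pr y z n φ =
  tri (λ m k → pr (E y z m) (W y z k) φ) 0 (suc n) - tri (λ m k → pr (z ◂ E y z m) (V y z k) φ) 0 n

2ℚ : ℚ
2ℚ = 1ℚ + 1ℚ

-- Three-letter recursion for the alternating sum of shuffles

module Shuffle (y z : Letter) where

  e w w' v r f : ℕ → Poly
  e = E y z
  w = W y z
  w' = W z y
  v = V y z
  r = R y z
  f = F y z

  -- If `w k` is nonempty, its initial `z` may also come first; the two resulting terms recombine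
  -- into `f m`, which gives the padded summand.
  FW : ∀ φ m k → sh (f m) (w k) φ
    ≡ sh (z ◂ e m) (w k) (φ ∘ (y ∷_)) + sh (y ◂ e m) (w k) (φ ∘ (z ∷_))
    + shiftʳ (λ m k → sh (f m) (v k) (φ ∘ (z ∷_))) m k
  FW φ m zero = begin
    _ ≡⟨ sh-⊕ˡ (y ◂ z ◂ e m) (z ◂ y ◂ e m) one φ ⟩
    _ ≡⟨ cong₂ _+_ (sh-peelˡ y (z ◂ e m) φ) (sh-peelˡ z (y ◂ e m) φ) ⟩
    _ ≡⟨ sym (+-identityʳ _) ⟩
    _ ∎
  FW φ m (suc k) = begin
    _ ≡⟨ sh-⊕ˡ (y ◂ z ◂ e m) (z ◂ y ◂ e m) (z ◂ v k) φ ⟩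
    _ ≡⟨ cong₂ _+_ (sh-peel y z (z ◂ e m) (v k) φ) (sh-peel z z (y ◂ e m) (v k) φ) ⟩
    _ ≡⟨ solve 4 (λ p q r s → (p :+ q) :+ (r :+ s) := p :+ r :+ (q :+ s)) refl
           (sh (z ◂ e m) (w (suc k)) _) (sh (y ◂ z ◂ e m) (v k) _)
           (sh (y ◂ e m) (w (suc k)) _) (sh (z ◂ y ◂ e m) (v k) _) ⟩
    _ ≡⟨ cong (sh (z ◂ e m) (w (suc k)) _ + sh (y ◂ e m) (w (suc k)) _ +_)
           (sym (sh-⊕ˡ (y ◂ z ◂ e m) (z ◂ y ◂ e m) (v k) (φ ∘ (z ∷_)))) ⟩
    _ ∎

  zER : ∀ φ m k → sh (z ◂ e m) (r k) φ
    ≡ sh (z ◂ e m) (w k) (φ ∘ (y ∷_)) + sh (e m) (r k) (φ ∘ (z ∷_)) + sh (z ◂ e m) (w' k) (φ ∘ (z ∷_))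
  zER φ m k = begin
    _ ≡⟨ sh-⊕ʳ (z ◂ e m) (y ◂ w k) (z ◂ w' k) φ ⟩
    _ ≡⟨ cong₂ _+_ (sh-peel z y (e m) (w k) φ) (sh-peel z z (e m) (w' k) φ) ⟩
    _ ≡⟨ solve 4 (λ p q r s → (p :+ q) :+ (r :+ s) := q :+ (p :+ r) :+ s) refl
           (sh (e m) (y ◂ w k) _) (sh (z ◂ e m) (w k) _)
           (sh (e m) (z ◂ w' k) _) (sh (z ◂ e m) (w' k) _) ⟩
    _ ≡⟨ cong (λ t → sh (z ◂ e m) (w k) _ + t + sh (z ◂ e m) (w' k) _)
           (sym (sh-⊕ʳ (e m) (y ◂ w k) (z ◂ w' k) (φ ∘ (z ∷_)))) ⟩
    _ ∎

  yEW : ∀ φ m k → sh (y ◂ e m) (w k) φ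
    ≡ sh (e m) (w k) (φ ∘ (y ∷_)) + shiftʳ (λ m k → sh (y ◂ e m) (v k) (φ ∘ (z ∷_))) m k
  yEW φ m zero = trans (sh-peelˡ y (e m) φ) (sym (+-identityʳ _))
  yEW φ m (suc k) = sh-peel y z (e m) (v k) φ

  zEW' : ∀ φ m k → sh (z ◂ e m) (w' k) φ
    ≡ sh (e m) (w' k) (φ ∘ (z ∷_)) + shiftʳ (λ m k → sh (z ◂ e m) (v k) (φ ∘ (y ∷_))) m k
  zEW' φ m zero = trans (sh-peelˡ z (e m) φ) (sym (+-identityʳ _))
  zEW' φ m (suc k) = trans (sh-peel z y (e m) (V z y k) φ)
    (cong (sh (e m) (w' (suc k)) _ +_) (sh-congʳ (z ◂ e m) (V z y k) (v k) (φ ∘ (y ∷_)) (V-sym z y k)))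

  -- The letter `a` on the left is available only when `e m` is not the empty word, hence the left
  -- shift.
  ER : ∀ φ m k → sh (e m) (r k) φ
    ≡ sh (e m) (w k) (φ ∘ (y ∷_)) + sh (e m) (w' k) (φ ∘ (z ∷_))
    + shiftˡ (λ m k → sh (f m) (r k) (φ ∘ (a ∷_))) m k
  ER φ zero k = begin
    _ ≡⟨ sh-⊕ʳ one (y ◂ w k) (z ◂ w' k) φ ⟩
    _ ≡⟨ cong₂ _+_ (sh-peelʳ y (w k) φ) (sh-peelʳ z (w' k) φ) ⟩
    _ ≡⟨ sym (+-identityʳ _) ⟩
    _ ∎
  ER φ (suc m) k = begin
    _ ≡⟨ sh-⊕ʳ (a ◂ f m) (y ◂ w k) (z ◂ w' k) φ ⟩
    _ ≡⟨ cong₂ _+_ (sh-peel a y (f m) (w k) φ) (sh-peel a z (f m) (w' k) φ) ⟩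
    _ ≡⟨ solve 4 (λ p q r s → (p :+ q) :+ (r :+ s) := q :+ s :+ (p :+ r)) refl
           (sh (f m) (y ◂ w k) _) (sh (e (suc m)) (w k) _)
           (sh (f m) (z ◂ w' k) _) (sh (e (suc m)) (w' k) _) ⟩
    _ ≡⟨ cong (sh (e (suc m)) (w k) _ + sh (e (suc m)) (w' k) _ +_)
           (sym (sh-⊕ʳ (f m) (y ◂ w k) (z ◂ w' k) (φ ∘ (a ∷_)))) ⟩
    _ ∎

  FV : ∀ φ m k → sh (f m) (v k) φ
    ≡ sh (z ◂ e m) (v k) (φ ∘ (y ∷_)) + sh (y ◂ e m) (v k) (φ ∘ (z ∷_))
    + sh (f m) (r k) (φ ∘ (a ∷_))
  FV φ m k = begin
    _ ≡⟨ sh-⊕ˡ (y ◂ z ◂ e m) (z ◂ y ◂ e m) (v k) φ ⟩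
    _ ≡⟨ cong₂ _+_ (sh-peel y a (z ◂ e m) (r k) φ) (sh-peel z a (y ◂ e m) (r k) φ) ⟩
    _ ≡⟨ solve 4 (λ p q r s → (p :+ q) :+ (r :+ s) := p :+ r :+ (q :+ s)) refl
           (sh (z ◂ e m) (v k) _) (sh (y ◂ z ◂ e m) (r k) _)
           (sh (y ◂ e m) (v k) _) (sh (z ◂ y ◂ e m) (r k) _) ⟩
    _ ≡⟨ cong (sh (z ◂ e m) (v k) _ + sh (y ◂ e m) (v k) _ +_)
           (sym (sh-⊕ˡ (y ◂ z ◂ e m) (z ◂ y ◂ e m) (r k) (φ ∘ (a ∷_)))) ⟩
    _ ∎

  ze ye : ℕ → Poly
  ze m = z ◂ e m
  ye m = y ◂ e m

  infix 7 _⊠_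
  _⊠_ : (ℕ → Poly) → (ℕ → Poly) → (Word → ℚ) → ℕ → ℕ → ℚ
  (p ⊠ q) φ m k = sh (p m) (q k) φ

  -- A first letter `z` leaves `e ⊠ v` in both sums, over the same antidiagonal; these cancel and
  -- only `a` remains.
  peel-a : ∀ n φ → alternating sh y z (suc n) φ
    ≡ tri ((f ⊠ w) (φ ∘ (a ∷_))) 0 (suc n) - tri ((ze ⊠ r) (φ ∘ (a ∷_))) 0 (suc n)
  peel-a n φ = begin
    _ ≡⟨ cong₂ _-_
           (tri-peel ((e ⊠ w) φ) ((f ⊠ w) φa) ((e ⊠ v) φz)
             (λ m → sh-peelˡ a (f m) φ) (λ k → sh-peelʳ z (v k) φ)
             (λ m k → sh-peel a z (f m) (v k) φ) n)
           (tri-split ((e ⊠ v) φz) ((ze ⊠ r) φa) (λ m k → sh-peel z a (e m) (r k) φ) 0 (suc n)) ⟩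
    _ ≡⟨ solve 3 (λ p q r → p :+ q :- (q :+ r) := p :- r) refl
           (tri ((f ⊠ w) φa) 0 (suc n)) (tri ((e ⊠ v) φz) 0 (suc n)) (tri ((ze ⊠ r) φa) 0 (suc n)) ⟩
    _ ∎
    where
    φa = φ ∘ (a ∷_)
    φz = φ ∘ (z ∷_)

  -- A second letter `y` leaves `ze ⊠ w` in both sums; these cancel and only `z` remains.
  peel-z : ∀ n φ → tri ((f ⊠ w) φ) 0 (suc n) - tri ((ze ⊠ r) φ) 0 (suc n)
    ≡ tri ((ye ⊠ w) (φ ∘ (z ∷_))) 0 (suc n) + tri ((f ⊠ v) (φ ∘ (z ∷_))) 0 n
    - (tri ((e ⊠ r) (φ ∘ (z ∷_))) 0 (suc n) + tri ((ze ⊠ w') (φ ∘ (z ∷_))) 0 (suc n))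
  peel-z n φ = begin
    _ ≡⟨ cong₂ _-_
           (trans (tri-split₃ ((ze ⊠ w) φy) ((ye ⊠ w) φz) (shiftʳ ((f ⊠ v) φz)) (FW φ) 0 (suc n))
             (cong (tri ((ze ⊠ w) φy) 0 (suc n) + tri ((ye ⊠ w) φz) 0 (suc n) +_)
               (tri-shiftʳ ((f ⊠ v) φz) 0 n)))
           (tri-split₃ ((ze ⊠ w) φy) ((e ⊠ r) φz) ((ze ⊠ w') φz) (zER φ) 0 (suc n)) ⟩
    _ ≡⟨ solve 5 (λ p q r s t → p :+ q :+ r :- (p :+ s :+ t) := q :+ r :- (s :+ t)) refl
           (tri ((ze ⊠ w) φy) 0 (suc n)) (tri ((ye ⊠ w) φz) 0 (suc n)) (tri ((f ⊠ v) φz) 0 n)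
           (tri ((e ⊠ r) φz) 0 (suc n)) (tri ((ze ⊠ w') φz) 0 (suc n)) ⟩
    _ ∎
    where
    φy = φ ∘ (y ∷_)
    φz = φ ∘ (z ∷_)

  -- Third letters `y` and `a` cancel. With `z`, the first two sums each give `ye ⊠ v` and the last
  -- two each give `e ⊠ w'`; this is the source of the factor 2.
  peel-zz : ∀ n φ → tri ((ye ⊠ w) φ) 0 (suc n) + tri ((f ⊠ v) φ) 0 n
    - (tri ((e ⊠ r) φ) 0 (suc n) + tri ((ze ⊠ w') φ) 0 (suc n))
    ≡ - (2ℚ * alternating sh z y n (φ ∘ (z ∷_)))
  peel-zz n φ = begin
    _ ≡⟨ cong₂ _-_
           (cong₂ _+_
             (tri-splitʳ ((e ⊠ w) φy) ((ye ⊠ v) φz) (yEW φ) n)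
             (tri-split₃ ((ze ⊠ v) φy) ((ye ⊠ v) φz) ((f ⊠ r) φa) (FV φ) 0 n))
           (cong₂ _+_
             (trans (tri-split₃ ((e ⊠ w) φy) ((e ⊠ w') φz) (shiftˡ ((f ⊠ r) φa)) (ER φ) 0 (suc n))
               (cong (tri ((e ⊠ w) φy) 0 (suc n) + tri ((e ⊠ w') φz) 0 (suc n) +_)
                 (tri-shiftˡ ((f ⊠ r) φa) n)))
             (tri-splitʳ ((e ⊠ w') φz) ((ze ⊠ v) φy) (zEW' φ) n)) ⟩
    _ ≡⟨ solve 5 (λ ew yev zev fr ew' → (ew :+ yev) :+ (zev :+ yev :+ fr) :- (ew :+ ew' :+ fr :+ (ew' :+ zev))
             := :- ((con 1ℚ :+ con 1ℚ) :* (ew' :- yev))) refl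
           (tri ((e ⊠ w) φy) 0 (suc n)) (tri ((ye ⊠ v) φz) 0 n) (tri ((ze ⊠ v) φy) 0 n)
           (tri ((f ⊠ r) φa) 0 n) (tri ((e ⊠ w') φz) 0 (suc n)) ⟩
    - (2ℚ * (tri ((e ⊠ w') φz) 0 (suc n) - tri ((ye ⊠ v) φz) 0 n))
      ≡⟨ cong (λ t → - (2ℚ * t)) (cong₂ _-_
           (tri-cong (λ m k → sh-congˡ (e m) (E z y m) (w' k) φz (E-sym y z m)) 0 (suc n))
           (tri-cong (λ m k → trans
             (sh-congˡ (ye m) (y ◂ E z y m) (v k) φz (◂-cong y (e m) (E z y m) (E-sym y z m)))
             (sh-congʳ (y ◂ E z y m) (v k) (V z y k) φz (V-sym y z k))) 0 n)) ⟩
    _ ∎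
    where
    φa = φ ∘ (a ∷_)
    φy = φ ∘ (y ∷_)
    φz = φ ∘ (z ∷_)

  alternating-suc : ∀ n φ → alternating sh y z (suc n) φ
    ≡ - (2ℚ * alternating sh z y n (φ ∘ (λ u → a ∷ z ∷ z ∷ u)))
  alternating-suc n φ = trans (peel-a n φ)
    (trans (peel-z n (φ ∘ (a ∷_))) (peel-zz n (φ ∘ (λ u → a ∷ z ∷ u))))

-- Action of the swap of b and c on the basic sequences

ev-swap-E : ∀ y z m φ → ev (E y z m) (φ ∘ map swapL) ≡ ev (E (swapL y) (swapL z) m) φ
ev-swap-E y z zero φ = refl
ev-swap-E y z (suc m) φ = begin
  _ ≡⟨ ev-E y z m (φ ∘ map swapL) ⟩
  _ ≡⟨ cong₂ _+_ (step z _) (step y _) ⟩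
  _ ≡⟨ sym (ev-E (swapL y) (swapL z) m φ) ⟩
  _ ∎
  where
  step : ∀ x ψ → ev (x ◂ E y z m) (ψ ∘ map swapL) ≡ ev (swapL x ◂ E (swapL y) (swapL z) m) ψ
  step x ψ = trans (ev-◂ x (E y z m) (ψ ∘ map swapL))
    (trans (ev-swap-E y z m (ψ ∘ (swapL x ∷_))) (sym (ev-◂ (swapL x) (E (swapL y) (swapL z) m) ψ)))

ev-swap-W : ∀ y z k φ → ev (W y z k) (φ ∘ map swapL) ≡ ev (W (swapL y) (swapL z) k) φ
ev-swap-V : ∀ y z k φ → ev (V y z k) (φ ∘ map swapL) ≡ ev (V (swapL y) (swapL z) k) φ
ev-swap-W y z zero φ = refl
ev-swap-W y z (suc k) φ = begin
  _ ≡⟨ ev-◂ z (V y z k) (φ ∘ map swapL) ⟩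
  _ ≡⟨ ev-swap-V y z k (φ ∘ (swapL z ∷_)) ⟩
  _ ≡⟨ sym (ev-◂ (swapL z) (V (swapL y) (swapL z) k) φ) ⟩
  _ ∎
ev-swap-V y z k φ = begin
  _ ≡⟨ ev-V y z k (φ ∘ map swapL) ⟩
  _ ≡⟨ cong₂ _+_ (ev-swap-W y z k (φ ∘ (λ u → a ∷ swapL y ∷ u)))
                 (ev-swap-W z y k (φ ∘ (λ u → a ∷ swapL z ∷ u))) ⟩
  _ ≡⟨ sym (ev-V (swapL y) (swapL z) k φ) ⟩
  _ ∎

-- Block recursion for the alternating sum of stuffles

module Stuffle where

  e w w' v ce be : ℕ → Poly
  e = E b c
  w = W b c
  w' = W c b
  v = V b c
  ce m = c ◂ e m
  be m = b ◂ e m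

  β₂ γ₁ γ₂ β₃ γ₃ : Block
  β₂ = false , 1
  γ₁ = true , 0
  γ₂ = true , 1
  β₃ = false , 2
  γ₃ = true , 2

  swap-e : ∀ m → swapPoly (e m) ≃ e m
  swap-e m φ = trans (ev-swap (e m) φ) (trans (ev-swap-E b c m φ) (E-sym c b m φ))

  -- Splitting `β₂` or `γ₂` off `e (suc m)` leaves `ce m` or `be m`, and the twist by `γ₂` turns the
  -- latter into `ce m`: both blocks leave the same factor. `swap-w'` does the same for `v`.
  swap-be : ∀ m → swapPoly (be m) ≃ ce m
  swap-be m φ = begin
    ev (swapPoly (be m)) φ             ≡⟨ ev-swap (be m) φ ⟩
    ev (be m) (φ ∘ map swapL)          ≡⟨ ev-◂ b (e m) (φ ∘ map swapL) ⟩
    ev (e m) (φ ∘ (c ∷_) ∘ map swapL)  ≡⟨ sym (ev-swap (e m) (φ ∘ (c ∷_))) ⟩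
    ev (swapPoly (e m)) (φ ∘ (c ∷_))   ≡⟨ swap-e m (φ ∘ (c ∷_)) ⟩
    ev (e m) (φ ∘ (c ∷_))              ≡⟨ sym (ev-◂ c (e m) φ) ⟩
    ev (ce m) φ                        ∎

  swap-w' : ∀ k → swapPoly (w' k) ≃ w k
  swap-w' k φ = trans (ev-swap (w' k) φ) (ev-swap-W c b k φ)

  swap-v : ∀ k → swapPoly (v k) ≃ v k
  swap-v k φ = trans (ev-swap (v k) φ) (trans (ev-swap-V b c k φ) (V-sym c b k φ))

  e-blocks : ∀ m → e (suc m) ≃ (β₂ ◃ ce m) ⊕ (γ₂ ◃ be m)
  e-blocks m φ = trans (ev-E b c m φ) (sym (trans (ev-⊕ (β₂ ◃ ce m) (γ₂ ◃ be m) φ)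
    (cong₂ _+_ (ev-prefix (blockWord β₂) (ce m) φ) (ev-prefix (blockWord γ₂) (be m) φ))))

  v-blocks : ∀ k → v k ≃ (β₂ ◃ w k) ⊕ (γ₂ ◃ w' k)
  v-blocks k φ = trans (ev-V b c k φ) (sym (trans (ev-⊕ (β₂ ◃ w k) (γ₂ ◃ w' k) φ)
    (cong₂ _+_ (ev-prefix (blockWord β₂) (w k) φ) (ev-prefix (blockWord γ₂) (w' k) φ))))

  e-st : ∀ m q φ → st (e (suc m)) q φ ≡ st (β₂ ◃ ce m) q φ + st (γ₂ ◃ be m) q φ
  e-st m q φ = trans (st-congˡ (e (suc m)) ((β₂ ◃ ce m) ⊕ (γ₂ ◃ be m)) q φ (e-blocks m))
    (st-⊕ˡ (β₂ ◃ ce m) (γ₂ ◃ be m) q φ)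

  st-v : ∀ p k φ → st p (v k) φ ≡ st p (β₂ ◃ w k) φ + st p (γ₂ ◃ w' k) φ
  st-v p k φ = trans (st-congʳ p (v k) ((β₂ ◃ w k) ⊕ (γ₂ ◃ w' k)) φ (v-blocks k))
    (st-⊕ʳ p (β₂ ◃ w k) (γ₂ ◃ w' k) φ)

  st-cong : ∀ p p' q q' φ → p ≃ p' → q ≃ q' → st p q φ ≡ st p' q' φ
  st-cong p p' q q' φ e e' = trans (st-congˡ p p' q φ e) (st-congʳ p' q q' φ e')

  infix 7 _⊠_
  _⊠_ : (ℕ → Poly) → (ℕ → Poly) → (Word → ℚ) → ℕ → ℕ → ℚ
  (p ⊠ q) φ m k = st (p m) (q k) φ

  -- Contributions emitting a block of length two (`ceW`) or three (`ceV`, `eW`), summed over its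
  -- two types; thanks to the twists both types leave the same pair of factors.
  ceW ceV eW : (Word → ℚ) → ℕ → ℕ → ℚ
  ceW φ m k = (ce ⊠ w) (φ ∘M β₂) m k + (ce ⊠ w) (φ ∘M γ₂) m k
  ceV φ m k = (ce ⊠ v) (φ ∘M β₃) m k + (ce ⊠ v) (φ ∘M γ₃) m k
  eW φ m k = (e ⊠ w) (φ ∘M β₃) m k + (e ⊠ w) (φ ∘M γ₃) m k

  EW-suc-zero : ∀ φ m → (e ⊠ w) φ (suc m) 0 ≡ ceW φ m 0
  EW-suc-zero φ m = begin
    _ ≡⟨ e-st m one φ ⟩
    _ ≡⟨ cong₂ _+_ (st-peelˡ β₂ (ce m) φ) (trans (st-peelˡ γ₂ (be m) φ)
           (st-congˡ (swapPoly (be m)) (ce m) one (φ ∘M γ₂) (swap-be m))) ⟩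
    _ ∎

  EW-zero-suc : ∀ φ k → (e ⊠ w) φ 0 (suc k) ≡ (e ⊠ v) (φ ∘M γ₁) 0 k
  EW-zero-suc φ k = trans (st-peelʳ γ₁ (v k) φ)
    (st-congʳ one (swapPoly (v k)) (v k) (φ ∘M γ₁) (swap-v k))

  -- The brackets [β₂,γ₁] = γ₃ and [γ₂,γ₁] = β₃ produce `ceV`, and the two terms emitting `γ₁`
  -- recombine into `e (suc m)`.
  EW-suc-suc : ∀ φ m k → (e ⊠ w) φ (suc m) (suc k)
    ≡ ceW φ m (suc k) + ceV φ m k + (e ⊠ v) (φ ∘M γ₁) (suc m) k
  EW-suc-suc φ m k = begin
    _ ≡⟨ e-st m (w (suc k)) φ ⟩
    _ ≡⟨ cong₂ _+_
           (trans (st-peel β₂ γ₁ (ce m) (v k) φ) (cong₂ _+_ (cong₂ _+_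
             (refl {x = st (ce m) (w (suc k)) (φ ∘M β₂)})
             (st-congʳ (β₂ ◃ ce m) (swapPoly (v k)) (v k) (φ ∘M γ₁) (swap-v k)))
             (st-congʳ (ce m) (swapPoly (v k)) (v k) (φ ∘M γ₃) (swap-v k))))
           (trans (st-peel γ₂ γ₁ (be m) (v k) φ) (cong₂ _+_ (cong₂ _+_
             (st-congˡ (swapPoly (be m)) (ce m) (w (suc k)) (φ ∘M γ₂) (swap-be m))
             (st-congʳ (γ₂ ◃ be m) (swapPoly (v k)) (v k) (φ ∘M γ₁) (swap-v k)))
             (st-cong (swapPoly (be m)) (ce m) (swapPoly (v k)) (v k) (φ ∘M β₃) (swap-be m) (swap-v k)))) ⟩
    _ ≡⟨ solve 6 (λ p q r s t u → (p :+ q :+ r) :+ (s :+ t :+ u) := p :+ s :+ (u :+ r) :+ (q :+ t)) refl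
           ((ce ⊠ w) (φ ∘M β₂) m (suc k)) (st (β₂ ◃ ce m) (v k) (φ ∘M γ₁)) ((ce ⊠ v) (φ ∘M γ₃) m k)
           ((ce ⊠ w) (φ ∘M γ₂) m (suc k)) (st (γ₂ ◃ be m) (v k) (φ ∘M γ₁)) ((ce ⊠ v) (φ ∘M β₃) m k) ⟩
    _ ≡⟨ cong (ceW φ m (suc k) + ceV φ m k +_) (sym (e-st m (v k) (φ ∘M γ₁))) ⟩
    _ ∎

  -- Removing `γ₁` from `ce m` leaves the swap-invariant `e m`; the brackets with `β₂` and `γ₂`
  -- produce `eW`.
  ceV-peel : ∀ φ m k → (ce ⊠ v) φ m k ≡ ceW φ m k + (e ⊠ v) (φ ∘M γ₁) m k + eW φ m k
  ceV-peel φ m k = begin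
    _ ≡⟨ st-v (ce m) k φ ⟩
    _ ≡⟨ cong₂ _+_
           (trans (st-peel γ₁ β₂ (e m) (w k) φ) (cong₂ _+_ (cong₂ _+_
             (st-congˡ (swapPoly (e m)) (e m) (β₂ ◃ w k) (φ ∘M γ₁) (swap-e m))
             (refl {x = st (ce m) (w k) (φ ∘M β₂)}))
             (st-congˡ (swapPoly (e m)) (e m) (w k) (φ ∘M γ₃) (swap-e m))))
           (trans (st-peel γ₁ γ₂ (e m) (w' k) φ) (cong₂ _+_ (cong₂ _+_
             (st-congˡ (swapPoly (e m)) (e m) (γ₂ ◃ w' k) (φ ∘M γ₁) (swap-e m))
             (st-congʳ (ce m) (swapPoly (w' k)) (w k) (φ ∘M γ₂) (swap-w' k)))
             (st-cong (swapPoly (e m)) (e m) (swapPoly (w' k)) (w k) (φ ∘M β₃) (swap-e m) (swap-w' k)))) ⟩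
    _ ≡⟨ solve 6 (λ p q r s t u → (p :+ q :+ r) :+ (s :+ t :+ u) := q :+ t :+ (p :+ s) :+ (u :+ r)) refl
           (st (e m) (β₂ ◃ w k) (φ ∘M γ₁)) ((ce ⊠ w) (φ ∘M β₂) m k) ((e ⊠ w) (φ ∘M γ₃) m k)
           (st (e m) (γ₂ ◃ w' k) (φ ∘M γ₁)) ((ce ⊠ w) (φ ∘M γ₂) m k) ((e ⊠ w) (φ ∘M β₃) m k) ⟩
    _ ≡⟨ cong (λ t → ceW φ m k + t + eW φ m k) (sym (st-v (e m) k (φ ∘M γ₁))) ⟩
    _ ∎

  -- The terms emitting `γ₁`, `β₂` or `γ₂` agree in the two sums and cancel. The brackets survive,
  -- `ceV` in the first sum and `eW` in the second, so T_n reappears with the opposite sign, once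
  -- for `β₃` and once for `γ₃`.
  alternating-suc : ∀ n φ → alternating st b c (suc n) φ
    ≡ - (alternating st b c n (φ ∘M β₃) + alternating st b c n (φ ∘M γ₃))
  alternating-suc n φ = begin
    _ ≡⟨ cong₂ _-_
           (trans
             (tri-peel ((e ⊠ w) φ) (λ m k → ceW φ m k + shiftʳ (ceV φ) m k) ((e ⊠ v) (φ ∘M γ₁))
               (λ m → trans (EW-suc-zero φ m) (sym (+-identityʳ _))) (EW-zero-suc φ) (EW-suc-suc φ) n)
             (cong (_+ tri ((e ⊠ v) (φ ∘M γ₁)) 0 (suc n)) (tri-splitʳ (ceW φ) (ceV φ) (λ _ _ → refl) n)))
           (tri-split₃ (ceW φ) ((e ⊠ v) (φ ∘M γ₁)) (eW φ) (ceV-peel φ) 0 (suc n)) ⟩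
    _ ≡⟨ solve 4 (λ p q r s → p :+ q :+ r :- (p :+ r :+ s) := :- (s :- q)) refl
           (tri (ceW φ) 0 (suc n)) (tri (ceV φ) 0 n) (tri ((e ⊠ v) (φ ∘M γ₁)) 0 (suc n))
           (tri (eW φ) 0 (suc n)) ⟩
    - (tri (eW φ) 0 (suc n) - tri (ceV φ) 0 n)
      ≡⟨ cong -_ (cong₂ _-_
           (tri-+ ((e ⊠ w) (φ ∘M β₃)) ((e ⊠ w) (φ ∘M γ₃)) 0 (suc n))
           (tri-+ ((ce ⊠ v) (φ ∘M β₃)) ((ce ⊠ v) (φ ∘M γ₃)) 0 n)) ⟩
    _ ≡⟨ solve 4 (λ p q r s → :- (p :+ q :- (r :+ s)) := :- (p :- r :+ (q :- s))) refl
           (tri ((e ⊠ w) (φ ∘M β₃)) 0 (suc n)) (tri ((e ⊠ w) (φ ∘M γ₃)) 0 (suc n))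
           (tri ((ce ⊠ v) (φ ∘M β₃)) 0 n) (tri ((ce ⊠ v) (φ ∘M γ₃)) 0 n) ⟩
    _ ∎

-- Evaluation of the alternating sums

sgn : ℕ → ℚ
sgn n = if isEvenN n then 1ℚ else - 1ℚ

sgn-suc : ∀ n → sgn (suc n) ≡ - sgn n
sgn-suc n with isEvenN n
... | true = refl
... | false = refl

sgn² : ∀ n → sgn n * sgn n ≡ 1ℚ
sgn² n with isEvenN n
... | true = refl
... | false = refl

2^ : ℕ → ℚ
2^ n = (ℤ.+ (2 ℕ.^ n)) Data.Rational./ 1

2^-suc : ∀ n → 2^ (suc n) ≡ 2ℚ * 2^ n
-- The rational `_/_` normalises and is stuck on a variable numerator; among unnormalised rationals
-- only the numerators have to be multiplied.
2^-suc n = toℚᵘ-injective (ℚᵘ.≃-trans (toℚᵘ-fromℚᵘ (mkℚᵘ (ℤ.+ (2 ℕ.^ suc n)) 0))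
  (ℚᵘ.≃-sym (ℚᵘ.≃-trans (toℚᵘ-homo-* 2ℚ (2^ n))
    (ℚᵘ.≃-trans (ℚᵘ.*-congˡ {mkℚᵘ (ℤ.+ 2) 0} (toℚᵘ-fromℚᵘ (mkℚᵘ (ℤ.+ (2 ℕ.^ n)) 0)))
      (ℚᵘ.*≡* (cong (ℤ._* ℤ.+ 1) (sym (ℤ.pos-* 2 (2 ℕ.^ n)))))))))

-- Shaped like the shuffle recursion, which exchanges the letters at every step: acc abb acc and so
-- on.
target : Letter → Letter → ℕ → Word
target y z zero = []
target y z (suc n) = a ∷ z ∷ z ∷ target z y n

alternating-zero : ∀ pr y z φ x → pr one one φ ≡ x → alternating pr y z 0 φ ≡ 1ℚ * x
alternating-zero pr y z φ x refl =
  solve 1 (λ x → x :+ con 0ℚ :- con 0ℚ := con 1ℚ :* x) refl (pr one one φ)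

alternating-sh : ∀ y z n φ → alternating sh y z n φ ≡ sgn n * (2^ n * φ (target y z n))
alternating-sh y z zero φ = alternating-zero sh y z φ _
  (trans (sh-oneˡ one φ) (trans (ev-word [] (λ v → ev (word v) φ))
    (trans (ev-word [] φ) (sym (*-identityˡ (φ []))))))
alternating-sh y z (suc n) φ = begin
  _ ≡⟨ Shuffle.alternating-suc y z n φ ⟩
  _ ≡⟨ cong (λ t → - (2ℚ * t)) (alternating-sh z y n (φ ∘ (λ u → a ∷ z ∷ z ∷ u))) ⟩
  _ ≡⟨ solve 4 (λ t s p x → :- (t :* (s :* (p :* x))) := (:- s) :* (t :* p :* x)) refl
         2ℚ (sgn n) (2^ n) (φ (target y z (suc n))) ⟩
  _ ≡⟨ cong₂ (λ s p → s * (p * φ (target y z (suc n)))) (sym (sgn-suc n)) (sym (2^-suc n)) ⟩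
  _ ∎

target-wpow : ∀ n → target b c n
  ≡ wpow (a ∷ c ∷ c ∷ a ∷ b ∷ b ∷ []) (n ℕ./ 2) ++ wpow (a ∷ c ∷ c ∷ []) (n ℕ.% 2)
target-wpow zero = refl
target-wpow (suc zero) = refl
-- The remainder modulo 2 advances by computation; the quotient is computed with an accumulator and
-- needs a lemma.
target-wpow (suc (suc n)) rewrite m/n≡1+[m∸n]/n {suc (suc n)} {2} (ℕ.s≤s (ℕ.s≤s ℕ.z≤n)) =
  cong (λ u → a ∷ c ∷ c ∷ a ∷ b ∷ b ∷ u) (target-wpow n)

a²[b+c] : Poly
a²[b+c] = word (a ∷ a ∷ b ∷ []) ⊕ word (a ∷ a ∷ c ∷ [])

ev-power : ∀ n φ → ev (ppow a²[b+c] (suc n)) φ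
  ≡ ev (ppow a²[b+c] n) (φ ∘ (λ u → a ∷ a ∷ b ∷ u)) + ev (ppow a²[b+c] n) (φ ∘ (λ u → a ∷ a ∷ c ∷ u))
ev-power n φ = trans (ev-· a²[b+c] (ppow a²[b+c] n) φ)
  (solve 2 (λ x y → con 1ℚ :* x :+ (con 1ℚ :* y :+ con 0ℚ) := x :+ y) refl
    (ev (ppow a²[b+c] n) (φ ∘ (λ u → a ∷ a ∷ b ∷ u))) (ev (ppow a²[b+c] n) (φ ∘ (λ u → a ∷ a ∷ c ∷ u))))

-- By this invariance the twist in the `γ₃` term disappears, and the stuffle recursion becomes left
-- multiplication by -a²(b+c).
ev-swap-power : ∀ n φ → ev (ppow a²[b+c] n) (φ ∘ map swapL) ≡ ev (ppow a²[b+c] n) φ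
ev-swap-power zero φ = refl
ev-swap-power (suc n) φ = begin
  _ ≡⟨ ev-power n (φ ∘ map swapL) ⟩
  _ ≡⟨ cong₂ _+_ (ev-swap-power n φc) (ev-swap-power n φb) ⟩
  _ ≡⟨ +-comm (ev (ppow a²[b+c] n) φc) (ev (ppow a²[b+c] n) φb) ⟩
  _ ≡⟨ sym (ev-power n φ) ⟩
  _ ∎
  where
  φb = φ ∘ (λ u → a ∷ a ∷ b ∷ u)
  φc = φ ∘ (λ u → a ∷ a ∷ c ∷ u)

alternating-st : ∀ n φ → alternating st b c n φ ≡ sgn n * ev (ppow a²[b+c] n) φ
alternating-st zero φ = alternating-zero st b c φ _
  (trans (st-oneˡ one φ) (ev-word [] (λ v → ev (stW [] v) φ)))
alternating-st (suc n) φ = begin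
  _ ≡⟨ Stuffle.alternating-suc n φ ⟩
  _ ≡⟨ cong -_ (cong₂ _+_ (alternating-st n φb)
         (trans (alternating-st n (φc ∘ map swapL)) (cong (sgn n *_) (ev-swap-power n φc)))) ⟩
  _ ≡⟨ solve 3 (λ s x y → :- (s :* x :+ s :* y) := (:- s) :* (x :+ y)) refl
         (sgn n) (ev (ppow a²[b+c] n) φb) (ev (ppow a²[b+c] n) φc) ⟩
  _ ≡⟨ cong₂ _*_ (sym (sgn-suc n)) (sym (ev-power n φ)) ⟩
  _ ∎
  where
  φb = φ ∘ (λ u → a ∷ a ∷ b ∷ u)
  φc = φ ∘ (λ u → a ∷ a ∷ c ∷ u)

-- Evaluation of the ⋆-products P and S

ev-✶ : ∀ p q φ → ev (p ✶ q) φ ≡ ev₂ p q (λ u v → φ (starW u v))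
ev-✶ p q φ = trans (ev-bilin (λ u v → word (starW u v)) p q φ)
  (ev₂-cong p q (λ u v → ev-word (starW u v) φ))

-- What a ⋆-appended `c` becomes after a word with the given last letter.
next : Maybe Letter → Letter
next (just c) = b
next _ = c

starW-c : ∀ u → starW u (c ∷ []) ≡ u ++ next (lastL u) ∷ []
starW-c u with lastL u
... | nothing = refl
... | just a = refl
... | just b = refl
... | just c = refl

lastL-++ : ∀ u x y → lastL (u ++ x ∷ y ∷ []) ≡ just y
lastL-++ [] x y = refl
lastL-++ (s ∷ []) x y = refl
lastL-++ (s ∷ t ∷ u) x y = lastL-++ (t ∷ u) x y

ev-✶c : ∀ p φ → ev (p ✶ cP) φ ≡ ev p (λ u → φ (u ++ next (lastL u) ∷ []))
ev-✶c p φ = trans (ev-✶ p cP φ)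
  (ev-cong p (λ u → trans (ev-word (c ∷ []) (φ ∘ starW u)) (cong φ (starW-c u))))

ev-d : ∀ φ → ev dP φ ≡ φ (a ∷ b ∷ []) + φ (a ∷ c ∷ [])
ev-d φ = solve 2 (λ x y → con 1ℚ :* x :+ (con 1ℚ :* y :+ con 0ℚ) := x :+ y) refl
  (φ (a ∷ b ∷ [])) (φ (a ∷ c ∷ []))

-- Both words of d begin with `a`, so here ⋆ is plain concatenation.
ev-✶d : ∀ p φ → ev (p ✶ dP) φ ≡ ev p (λ u → φ (u ++ a ∷ b ∷ []) + φ (u ++ a ∷ c ∷ []))
ev-✶d p φ = trans (ev-✶ p dP φ) (ev-cong p (λ u → ev-d (φ ∘ starW u)))

dc cd : ℕ → List Poly
dc zero = []
dc (suc m) = dP ∷ cP ∷ dc m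
cd zero = []
cd (suc m) = cP ∷ dP ∷ cd m

ev-++[] : ∀ p φ → ev p φ ≡ ev p (λ u → ev one (λ v → φ (u ++ v)))
ev-++[] p φ = ev-cong p (λ u →
  sym (trans (ev-word [] (λ v → φ (u ++ v))) (cong φ (++-identityʳ u))))

-- The accumulator is arbitrary because ⋆ is evaluated from the left. Each `c` follows a d and
-- becomes the letter that d did not end in, so d ⋆ c = E; the next d begins with `a`, so the copies
-- of E concatenate.
ev-foldl-dc : ∀ m p φ → ev (foldl _✶_ p (dc m)) φ ≡ ev p (λ u → ev (E b c m) (λ v → φ (u ++ v)))
ev-foldl-dc zero p φ = ev-++[] p φ
ev-foldl-dc (suc m) p φ = begin
  _ ≡⟨ ev-foldl-dc m (p ✶ dP ✶ cP) φ ⟩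
  _ ≡⟨ ev-✶c (p ✶ dP) ψ ⟩
  _ ≡⟨ ev-✶d p (λ u → ψ (u ++ next (lastL u) ∷ [])) ⟩
  _ ≡⟨ ev-cong p (λ u → trans (cong₂ _+_ (step u b) (step u c)) (sym (ev-E b c m (λ v → φ (u ++ v))))) ⟩
  _ ∎
  where
  ψ : Word → ℚ
  ψ u = ev (E b c m) (λ v → φ (u ++ v))
  step : ∀ u x → (let u' = u ++ a ∷ x ∷ [] in ψ (u' ++ next (lastL u') ∷ []))
    ≡ ev (next (just x) ◂ E b c m) (λ v → φ (u ++ a ∷ x ∷ v))
  step u x rewrite lastL-++ u a x = sym (trans (ev-◂ (next (just x)) (E b c m) _)
    (ev-cong (E b c m) (λ v → cong φ (sym (trans
      (++-assoc (u ++ a ∷ x ∷ []) (next (just x) ∷ []) v) (++-assoc u (a ∷ x ∷ []) (next (just x) ∷ v)))))))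

-- What c ⋆ d ⋆ c ⋆ d ⋆ ⋯ appends to a word depends only on the last letter of that word.
Wafter : Maybe Letter → ℕ → Poly
Wafter l = W (swapL (next l)) (next l)

V-next : ∀ l k → V (swapL (next l)) (next l) k ≃ V b c k
V-next (just c) k φ = V-sym c b k φ
V-next (just a) k φ = refl
V-next (just b) k φ = refl
V-next nothing k φ = refl

-- Here the first `c` meets the end of the accumulator, hence the dependence on `lastL u`. After a
-- pair c, d the last letter is `b` or `c`, and these two cases are the summands of `V`.
ev-foldl-cd : ∀ k p φ →
  ev (foldl _✶_ p (cd k)) φ ≡ ev p (λ u → ev (Wafter (lastL u) k) (λ v → φ (u ++ v)))
ev-foldl-cd zero p φ = ev-++[] p φ
ev-foldl-cd (suc k) p φ = begin
  _ ≡⟨ ev-foldl-cd k (p ✶ cP ✶ dP) φ ⟩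
  _ ≡⟨ ev-✶d (p ✶ cP) ψ ⟩
  _ ≡⟨ ev-✶c p (λ u → ψ (u ++ a ∷ b ∷ []) + ψ (u ++ a ∷ c ∷ [])) ⟩
  _ ≡⟨ ev-cong p (λ u → trans (cong₂ _+_ (step u b) (step u c)) (collect u)) ⟩
  _ ∎
  where
  ψ : Word → ℚ
  ψ u = ev (Wafter (lastL u) k) (λ v → φ (u ++ v))
  step : ∀ u x → ψ ((u ++ next (lastL u) ∷ []) ++ a ∷ x ∷ [])
    ≡ ev (Wafter (just x) k) (λ v → φ (u ++ next (lastL u) ∷ a ∷ x ∷ v))
  step u x rewrite lastL-++ (u ++ next (lastL u) ∷ []) a x =
    ev-cong (Wafter (just x) k) (λ v → cong φ (trans
      (++-assoc (u ++ next (lastL u) ∷ []) (a ∷ x ∷ []) v)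
      (++-assoc u (next (lastL u) ∷ []) (a ∷ x ∷ v))))
  collect : ∀ u → let x = next (lastL u) in
    ev (W b c k) (λ v → φ (u ++ x ∷ a ∷ b ∷ v)) + ev (W c b k) (λ v → φ (u ++ x ∷ a ∷ c ∷ v))
    ≡ ev (Wafter (lastL u) (suc k)) (λ v → φ (u ++ v))
  collect u = sym (begin
    _ ≡⟨ ev-◂ x (V (swapL x) x k) (λ v → φ (u ++ v)) ⟩
    _ ≡⟨ V-next (lastL u) k (λ v → φ (u ++ x ∷ v)) ⟩
    _ ≡⟨ ev-V b c k (λ v → φ (u ++ x ∷ v)) ⟩
    _ ∎)
    where x = next (lastL u)

starList-dc : ∀ m → starList (dc m) ≃ E b c m
starList-dc m φ = trans (cong (λ p → ev p φ) (unit m))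
  (trans (ev-foldl-dc m one φ) (ev-word [] (λ u → ev (E b c m) (λ v → φ (u ++ v)))))
  where
  unit : ∀ m → starList (dc m) ≡ foldl _✶_ one (dc m)
  unit zero = refl
  unit (suc m) = refl

starList-c-dc : ∀ m → starList (cP ∷ dc m) ≃ c ◂ E b c m
starList-c-dc m φ = begin
  _ ≡⟨ ev-foldl-dc m cP φ ⟩
  _ ≡⟨ ev-word (c ∷ []) (λ u → ev (E b c m) (λ v → φ (u ++ v))) ⟩
  _ ≡⟨ sym (ev-◂ c (E b c m) φ) ⟩
  _ ∎

starList-cd : ∀ k → starList (cd k) ≃ W b c k
starList-cd k φ = trans (cong (λ p → ev p φ) (unit k))
  (trans (ev-foldl-cd k one φ) (ev-word [] (λ u → ev (Wafter (lastL u) k) (λ v → φ (u ++ v)))))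
  where
  unit : ∀ k → starList (cd k) ≡ foldl _✶_ one (cd k)
  unit zero = refl
  unit (suc k) = refl

starList-d-cd : ∀ k → starList (dP ∷ cd k) ≃ V b c k
starList-d-cd k φ = begin
  _ ≡⟨ ev-foldl-cd k dP φ ⟩
  _ ≡⟨ ev-d (λ u → ev (Wafter (lastL u) k) (λ v → φ (u ++ v))) ⟩
  _ ≡⟨ sym (ev-V b c k φ) ⟩
  _ ∎

-- Parities and index ranges of the factors of P and S

twice : ℕ → ℕ
twice zero = zero
twice (suc m) = suc (suc (twice m))

isEvenN-+-twice : ∀ n m → isEvenN (n ℕ.+ twice m) ≡ isEvenN n
isEvenN-+-twice n zero = cong isEvenN (ℕ.+-identityʳ n)
isEvenN-+-twice n (suc m)
  rewrite ℕ.+-suc n (suc (twice m)) | ℕ.+-suc n (twice m) | isEvenN-+-twice n m = not-involutive (isEvenN n)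

range-cd : ∀ i k → isEvenN i ≡ true → map L (range i (twice k)) ≡ cd k
range-cd i zero h = refl
range-cd i (suc k) h rewrite h =
  cong (λ l → cP ∷ dP ∷ l) (range-cd (suc (suc i)) k (cong (not ∘ not) h))

range-dc : ∀ i m → isEvenN i ≡ false → map L (range i (twice m)) ≡ dc m
range-dc i zero h = refl
range-dc i (suc m) h rewrite h =
  cong (λ l → dP ∷ cP ∷ l) (range-dc (suc (suc i)) m (cong (not ∘ not) h))

range-∷ʳ : ∀ i k → range i (suc k) ≡ range i k ++ suc (i ℕ.+ k) ∷ []
range-∷ʳ i zero = cong (λ j → suc j ∷ []) (sym (ℕ.+-identityʳ i))
range-∷ʳ i (suc k) = cong (suc i ∷_)
  (trans (range-∷ʳ (suc i) k) (cong (λ j → range (suc i) k ++ suc j ∷ []) (sym (ℕ.+-suc i k))))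

reverse-range : ∀ k → reverse (range 0 (suc k)) ≡ suc k ∷ reverse (range 0 k)
reverse-range k = trans (cong reverse (range-∷ʳ 0 k)) (reverse-++ (range 0 k) (suc k ∷ []))

reverse-range-dc : ∀ m → map L (reverse (range 0 (twice m))) ≡ dc m
reverse-range-dc zero = refl
reverse-range-dc (suc m)
  rewrite reverse-range (suc (twice m)) | reverse-range (twice m) | isEvenN-+-twice 0 m =
  cong (λ l → dP ∷ cP ∷ l) (reverse-range-dc m)

-- The descending order for even indices puts d first, so both parities of P rest on the same list
-- `dc m`.
P-even : ∀ m → P (twice m) ≃ E b c m
P-even m φ rewrite isEvenN-+-twice 0 m | reverse-range-dc m = starList-dc m φ

P-odd : ∀ m → P (suc (twice m)) ≃ c ◂ E b c m
P-odd m φ rewrite isEvenN-+-twice 0 m | range-dc 1 m refl = starList-c-dc m φ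

2*-twice : ∀ n → 2 ℕ.* n ≡ twice n
2*-twice zero = refl
2*-twice (suc n) = cong suc (trans (ℕ.+-suc n (n ℕ.+ 0)) (cong suc (2*-twice n)))

twice-∸ : ∀ m k → twice (m ℕ.+ k) ℕ.∸ twice m ≡ twice k
twice-∸ zero k = refl
twice-∸ (suc m) k = twice-∸ m k

twice-∸-suc : ∀ m k → twice (m ℕ.+ suc k) ℕ.∸ suc (twice m) ≡ suc (twice k)
twice-∸-suc zero k = refl
twice-∸-suc (suc m) k = twice-∸-suc m k

S-even : ∀ m k → S (m ℕ.+ k) (twice m) ≃ W b c k
S-even m k φ rewrite 2*-twice (m ℕ.+ k) | twice-∸ m k
  | range-cd (twice m) k (isEvenN-+-twice 0 m) = starList-cd k φ

S-odd : ∀ m k → S (m ℕ.+ suc k) (suc (twice m)) ≃ V b c k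
S-odd m k φ rewrite 2*-twice (m ℕ.+ suc k) | twice-∸-suc m k | isEvenN-+-twice 0 m
  | range-cd (suc (suc (twice m))) k (isEvenN-+-twice 0 (suc m)) = starList-d-cd k φ

-- Assembly of the alternating sum

sh-st : Poly → Poly → (Word → ℚ) → ℚ
sh-st p q φ = sh p q φ - st p q φ

sh-st-cong : ∀ p p' q q' φ → p ≃ p' → q ≃ q' → sh-st p q φ ≡ sh-st p' q' φ
sh-st-cong p p' q q' φ e e' = cong₂ _-_
  (trans (sh-congˡ p p' q φ e) (sh-congʳ p' q q' φ e'))
  (trans (st-congˡ p p' q φ e) (st-congʳ p' q q' φ e'))

ev-Δ : ∀ n i φ → ev (Δ n i) φ ≡ sh-st (P i) (S n i) φ
ev-Δ n i φ = begin
  _ ≡⟨ ev-⊕ (P i ш S n i) (scale (- 1ℚ) (P i ⋆st S n i)) φ ⟩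
  _ ≡⟨ cong₂ _+_ (ev-bilin shW (P i) (S n i) φ)
         (trans (ev-scale (- 1ℚ) (P i ⋆st S n i) φ)
           (trans (cong (- 1ℚ *_) (ev-bilin stW (P i) (S n i) φ)) (neg (st (P i) (S n i) φ)))) ⟩
  _ ∎
  where
  neg : ∀ x → - 1ℚ * x ≡ - x
  neg = solve 1 (λ x → (:- con 1ℚ) :* x := :- x) refl

ev-concatMap-Δ : ∀ m k φ →
  ev (concatMap (λ i → scale (sign (m ℕ.+ k) i) (Δ (m ℕ.+ k) i)) (twice m ∷ range (twice m) (twice k))) φ
  ≡ sgn (m ℕ.+ k) * (tri (λ i j → sh-st (E b c i) (W b c j) φ) m (suc k)
                     - tri (λ i j → sh-st (c ◂ E b c i) (V b c j) φ) m k)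
ev-concatMap-Δ m k φ = go m k refl
  where
  n = m ℕ.+ k
  A B : ℕ → ℕ → ℚ
  A i j = sh-st (E b c i) (W b c j) φ
  B i j = sh-st (c ◂ E b c i) (V b c j) φ
  t : ℕ → Poly
  t i = scale (sign n i) (Δ n i)
  even : ∀ m k → m ℕ.+ k ≡ n → ev (t (twice m)) φ ≡ sgn n * A m k
  even m k h = trans (ev-scale (sign n (twice m)) (Δ n (twice m)) φ) (cong₂ _*_
    (cong (λ s → if s then 1ℚ else - 1ℚ) (isEvenN-+-twice n m))
    (trans (ev-Δ n (twice m) φ) (sh-st-cong (P (twice m)) (E b c m) (S n (twice m)) (W b c k) φ (P-even m)
      (subst (λ n → S n (twice m) ≃ W b c k) h (S-even m k)))))
  odd : ∀ m k → m ℕ.+ suc k ≡ n → ev (t (suc (twice m))) φ ≡ - sgn n * B m k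
  odd m k h = trans (ev-scale (sign n (suc (twice m))) (Δ n (suc (twice m))) φ) (cong₂ _*_
    (trans (cong sgn (ℕ.+-suc n (twice m))) (trans (sgn-suc (n ℕ.+ twice m))
      (cong (λ s → - (if s then 1ℚ else - 1ℚ)) (isEvenN-+-twice n m))))
    (trans (ev-Δ n (suc (twice m)) φ)
      (sh-st-cong (P (suc (twice m))) (c ◂ E b c m) (S n (suc (twice m))) (V b c k) φ (P-odd m)
        (subst (λ n → S n (suc (twice m)) ≃ V b c k) h (S-odd m k)))))
  -- `n` is fixed while `m` grows and `k` shrinks, so the sign and `S n` stay the same. Each step
  -- consumes an even and an odd index; the last even index stands alone, hence `suc k` against `k`.
  go : ∀ m k → m ℕ.+ k ≡ n → ev (concatMap t (twice m ∷ range (twice m) (twice k))) φ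
    ≡ sgn n * (tri A m (suc k) - tri B m k)
  go m zero h = begin
    _ ≡⟨ ev-⊕ (t (twice m)) [] φ ⟩
    _ ≡⟨ cong (_+ 0ℚ) (even m 0 h) ⟩
    _ ≡⟨ solve 2 (λ s x → s :* x :+ con 0ℚ := s :* (x :+ con 0ℚ :- con 0ℚ)) refl (sgn n) (A m 0) ⟩
    _ ∎
  go m (suc k) h = begin
    _ ≡⟨ ev-⊕ (t (twice m)) (t (suc (twice m)) ++ rest) φ ⟩
    _ ≡⟨ cong₂ _+_ (even m (suc k) h) (trans (ev-⊕ (t (suc (twice m))) rest φ)
           (cong₂ _+_ (odd m k h) (go (suc m) k (trans (sym (ℕ.+-suc m k)) h)))) ⟩
    _ ≡⟨ solve 5 (λ s x y z w → s :* x :+ ((:- s) :* y :+ s :* (z :- w)) := s :* (x :+ z :- (y :+ w))) refl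
           (sgn n) (A m (suc k)) (B m k) (tri A (suc m) (suc k)) (tri B (suc m) k) ⟩
    _ ∎
    where rest = concatMap t (twice (suc m) ∷ range (twice (suc m)) (twice k))

tri-- : ∀ f g m n → tri (λ i j → f i j - g i j) m n ≡ tri f m n - tri g m n
tri-- f g m zero = refl
tri-- f g m (suc n) = trans (cong (f m n - g m n +_) (tri-- f g (suc m) n))
  (solve 4 (λ x y z w → x :- y :+ (z :- w) := x :+ z :- (y :+ w)) refl
    (f m n) (g m n) (tri f (suc m) n) (tri g (suc m) n))

ev-sumΔ : ∀ n φ → ev (sumΔ n) φ ≡ sgn n * (alternating sh b c n φ - alternating st b c n φ)
ev-sumΔ n φ = begin
  _ ≡⟨ cong (λ j → ev (concatMap (λ i → scale (sign n i) (Δ n i)) (0 ∷ range 0 j)) φ) (2*-twice n) ⟩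
  _ ≡⟨ ev-concatMap-Δ 0 n φ ⟩
  _ ≡⟨ cong (sgn n *_) (trans
         (cong₂ _-_ (tri-- (ew sh) (ew st) 0 (suc n)) (tri-- (cev sh) (cev st) 0 n))
         (solve 4 (λ p q r s → p :- q :- (r :- s) := p :- r :- (q :- s)) refl
           (tri (ew sh) 0 (suc n)) (tri (ew st) 0 (suc n)) (tri (cev sh) 0 n) (tri (cev st) 0 n))) ⟩
  _ ∎
  where
  ew cev : (Poly → Poly → (Word → ℚ) → ℚ) → ℕ → ℕ → ℚ
  ew pr i j = pr (E b c i) (W b c j) φ
  cev pr i j = pr (c ◂ E b c i) (V b c j) φ

lhs≃rhs : ∀ n → lhs n ≃ rhs n
lhs≃rhs n φ = begin
  ev (lhs n) φ
    ≡⟨ trans (ev-scale (2^ n) (word _) φ) (cong (2^ n *_) (trans (ev-word _ φ) (cong φ (sym (target-wpow n))))) ⟩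
  x ≡⟨ sym (*-identityˡ x) ⟩
  1ℚ * x ≡⟨ cong (_* x) (sym (sgn² n)) ⟩
  -- The sign occurs once in front of the sum and once in the value of T_n; adding and subtracting
  -- `y` exposes the difference of the two alternating sums.
  s * s * x ≡⟨ solve 3 (λ s x y → s :* s :* x := s :* s :* y :+ s :* (s :* x :- s :* y)) refl s x y ⟩
  s * s * y + s * (s * x - s * y)
    ≡⟨ cong₂ _+_ (trans (cong (_* y) (sgn² n)) (*-identityˡ y))
         (cong (s *_) (sym (cong₂ _-_ (alternating-sh b c n φ) (alternating-st n φ)))) ⟩
  y + s * (alternating sh b c n φ - alternating st b c n φ)
    ≡⟨ sym (trans (ev-⊕ (ppow a²[b+c] n) (sumΔ n) φ) (cong (y +_) (ev-sumΔ n φ))) ⟩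
  ev (rhs n) φ ∎
  where
  s = sgn n
  x = 2^ n * φ (target b c n)
  y = ev (ppow a²[b+c] n) φ

mainTheorem2 : (n : ℕ) → 1 ≤ n → lhs n ≈ rhs n
mainTheorem2 n _ = ≃⇒≈ {lhs n} {rhs n} (lhs≃rhs n)
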